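{- (a) For $n=5$ and for every $n\ge 7$, $\sigma(K_{3,1,1},n)=4n-2$; equivalently, $4n-2$ is the least even integer such that every $n$-term graphical sequence $S$ with $\sigma(S)\ge 4n-2$ is potentially $K_{3,1,1}$-graphic. (b) For $n=6$: if $S$ is a $6$-term graphical sequence with $\sigma(S)\ge 22$, then either $S$ is potentially $K_{3,1,1}$-graphic or $S=(4,4,4,4,4,4)$; moreover $(4,4,4,4,4,4)$ is not potentially $K_{3,1,1}$-graphic, and consequently $\sigma(K_{3,1,1},6)=26$.
   Context: A finite sequence $S=(d_1,\dots,d_n)$ of non-negative integers is graphical if it is the degree sequence of some simple graph on $n$ vertices (a realization of $S$). Write $\sigma(S)=d_1+\dots+d_n$. For a graph $H$, a graphical sequence $S$ is potentially $H$-graphical if some realization of $S$ contains $H$ as a subgraph. $K_{3,1,1}$ denotes the complete 3-partite graph with parts of sizes $3,1,1$. $\sigma(H,n)$ denotes the minimum even integer $l$ such that every $n$-term graphical sequence $S$ with $\sigma(S)\ge l$ is potentially $H$-graphical. -}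

module Defs where

open import Data.Bool.Base using (Bool; true; false; not)
open import Data.Fin.Base using (Fin)
open import Data.Fin.Patterns using (0F; 1F; 2F)
open import Data.Fin.Properties using (_≟_)
open import Data.Fin.Subset using (Subset; ∣_∣)
open import Data.Nat.Base using (ℕ; _≤_)
open import Data.Nat.Divisibility using (_∣_)
open import Data.Product.Base using (∃-syntax; _×_)
open import Data.Vec.Base using (Vec; []; _∷_; lookup; sum; tabulate)
open import Function.Definitions using (Injective)
open import Relation.Binary.PropositionalEquality
  using (_≡_; refl; sym; cong)
open import Relation.Nullary.Decidable using (yes; no; does; dec-true; dec-false)

record Graph (n : ℕ) : Set where
  field
    adj        : Fin n → Fin n → Bool
    adj-sym    : ∀ u v → adj u v ≡ adj v u
    adj-irrefl : ∀ v → adj v v ≡ false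

open Graph public

neighbours : ∀ {n} → Graph n → Fin n → Subset n
neighbours G v = tabulate (adj G v)

degree : ∀ {n} → Graph n → Fin n → ℕ
degree G v = ∣ neighbours G v ∣

-- Subgraph containment up to isomorphism, not necessarily induced.
Contains : ∀ {m n} → Graph n → Graph m → Set
Contains {m} {n} G H =
  ∃[ f ] Injective {A = Fin m} {B = Fin n} _≡_ _≡_ f ×
         (∀ u v → adj H u v ≡ true → adj G (f u) (f v) ≡ true)

-- Sequences are not assumed to be sorted: vertex i has the i-th term as degree.
Realizes : ∀ {n} → Graph n → Vec ℕ n → Set
Realizes G S = ∀ i → degree G i ≡ lookup S i

Graphical : ∀ {n} → Vec ℕ n → Set
Graphical {n} S = ∃[ G ] Realizes {n} G S

PotentiallyGraphical : ∀ {m n} → Graph m → Vec ℕ n → Set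
PotentiallyGraphical {n = n} H S = ∃[ G ] Realizes {n} G S × Contains G H

SumForces : ∀ {m} → Graph m → ℕ → ℕ → Set
SumForces H n l =
  (S : Vec ℕ n) → Graphical S → l ≤ sum S → PotentiallyGraphical H S

-- σ⟨ H , n ⟩= l is the assertion σ(H, n) = l, where σ(H, n) is the minimum
-- even l such that every n-term graphical sequence of sum at least l is
-- potentially H-graphical.
record σ⟨_,_⟩=_ {m} (H : Graph m) (n l : ℕ) : Set where
  field
    even    : 2 ∣ l
    forces  : SumForces H n l
    minimum : ∀ l′ → 2 ∣ l′ → SumForces H n l′ → l ≤ l′

-- The complete multipartite graph whose parts are the fibres of p.
completeMultipartite : ∀ {n k} → (Fin n → Fin k) → Graph n
completeMultipartite p = record
  { adj        = λ u v → not (does (p u ≟ p v))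
  ; adj-sym    = λ u v → cong not (does-sym (p u) (p v))
  ; adj-irrefl = λ v → cong not (dec-true (p v ≟ p v) refl)
  }
  where
  does-sym : ∀ {k} (a b : Fin k) → does (a ≟ b) ≡ does (b ≟ a)
  does-sym a b with b ≟ a
  ... | yes b≡a = dec-true  (a ≟ b) (sym b≡a)
  ... | no  b≢a = dec-false (a ≟ b) (λ a≡b → b≢a (sym a≡b))

K₃,₁,₁ : Graph 5
K₃,₁,₁ = completeMultipartite {k = 3} (lookup (0F ∷ 0F ∷ 0F ∷ 1F ∷ 2F ∷ []))

{-# OPTIONS --safe #-}
-- K₃,₁,₁ is a book: two adjacent hubs with three common neighbours (the pages).
--
-- Upper bound.  By induction on n ≥ 4, a graph with degree sum at least 4n − 2 has the same degrees
-- as a graph containing a book, unless it is 4-regular on 6 vertices; for n = 4 there is no such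
-- graph.  Let v have least degree.  If G ∖ v has enough edges, realize its degrees with a book and
-- put v back.  Counting leaves two cases.  If G is 4-regular, use an explicit graph.  If v has
-- degree 3, then either G contains a book, or the neighbours of v can be named x, y, z so that some
-- graph on the other vertices has the degrees of G ∖ v, raised by one at x and y.  That graph may be
-- taken to contain a book, and some edge ab avoiding z can be deleted from it without destroying
-- all books; joining v to a, b and z restores the degrees.
--
-- Lower bound.  Both hubs have degree at least 4, so the sequence n − 1, 3, …, 3 of sum 4n − 4 is not
-- potentially K₃,₁,₁-graphical.
module Submission where

open import Defs
open import Data.Bool.Base using (Bool; true; false; not; _∧_; _∨_; if_then_else_)
open import Data.Bool.Properties
  using (∧-comm; ∧-zeroʳ; ∨-comm; ¬-not; not-injective)
  renaming (_≟_ to _≟ᵇ_)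
open import Data.Empty using (⊥)
open import Data.Fin.Base using (Fin; zero; suc; punchIn; punchOut; splitAt; _↑ˡ_; _↑ʳ_)
open import Data.Fin.Patterns using (0F; 1F; 2F; 3F; 4F; 5F; 6F; 7F; 8F)
open import Data.Fin.Properties
  using (_≟_; any?; all?; punchIn-injective; punchInᵢ≢i; punchIn-punchOut; splitAt-↑ˡ;
         splitAt-↑ʳ; ↑ˡ-injective)
open import Data.Fin.Subset using (∣_∣)
open import Data.List.Base using (List; []; _∷_; length; allFin)
open import Data.List.Extrema.Nat using (argmin; f[argmin]≤f[xs])
open import Data.List.Membership.Propositional using (_∈_; _∉_)
open import Data.List.Membership.Propositional.Properties using (∈-allFin)
open import Data.List.Relation.Unary.All as All using (All; []; _∷_)
open import Data.List.Relation.Unary.AllPairs using (AllPairs; []; _∷_)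
open import Data.List.Relation.Unary.Any using (here; there)
open import Data.Nat.Base using (ℕ; zero; suc; _+_; _*_; _∸_; _≤_; _<_; z≤n; s≤s)
open import Data.Nat.Divisibility using (_∣_; divides)
open import Data.Nat.Properties
  using (+-0-commutativeMonoid; +-assoc; +-comm; +-suc; +-identityʳ; +-cancelˡ-≤; +-cancelʳ-≤;
         +-cancelˡ-≡; +-cancelʳ-≡; +-mono-≤; *-zeroʳ; *-identityʳ; *-monoˡ-≤; *-cancelʳ-<;
         ≤-refl; ≤-reflexive; ≤-trans; ≤-antisym; ≤-pred; _≤?_; ≰⇒>; ≮⇒≥; <⇒≱; n<1+n; n≤1+n;
         m≤m+n; m≤n+m; m<m+n; m+n∸n≡m; n≤0⇒n≡0; n≢0⇒n>0; m≤n⇒m<n∨m≡n; m≤n⇒∃[o]m+o≡n;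
         suc-injective; module ≤-Reasoning)
  renaming (_≟_ to _≟ⁿ_)
open import Data.Nat.Tactic.RingSolver using (solve-∀)
open import Data.Product.Base using (_×_; _,_; ∃-syntax; proj₁; proj₂)
open import Data.Sum.Base using (_⊎_; inj₁; inj₂)
open import Data.Vec.Base using (Vec; []; _∷_; sum; lookup; tabulate)
open import Data.Vec.Functional using (insertAt)
open import Data.Vec.Functional.Properties using (insertAt-lookup; insertAt-punchIn)
open import Data.Vec.Properties using (lookup∘tabulate; tabulate∘lookup; tabulate-cong)
open import Data.Vec.Relation.Unary.All using ([]; _∷_)
open import Data.Vec.Relation.Unary.AllPairs using ([]; _∷_)
open import Data.Vec.Relation.Unary.Unique.Propositional using (Unique)
open import Data.Vec.Relation.Unary.Unique.Propositional.Properties using (lookup-injective)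
open import Function.Base using (_∘_; const; case_of_)
open import Function.Definitions using (Injective)
open import Relation.Binary.PropositionalEquality
  using (_≡_; _≢_; refl; sym; trans; cong; cong₂; subst; ≢-sym; module ≡-Reasoning)
open import Relation.Nullary.Decidable
  using (Dec; yes; no; does; dec-true; dec-false; decidable-stable; from-yes; ¬?; _×-dec_)
open import Relation.Nullary.Negation using (¬_; contradiction)
import Data.List.Membership.DecPropositional as DecMembership
open import Algebra.Properties.CommutativeMonoid.Sum +-0-commutativeMonoid
  using (sum-cong-≗; sum-remove; ∑-distrib-+) renaming (sum to ∑)

private variable
  k l m n : ℕ

-- Finite sums and counts

∑-mono : {f g : Fin n → ℕ} → (∀ i → f i ≤ g i) → ∑ f ≤ ∑ g
∑-mono {zero}  f≤g = z≤n
∑-mono {suc n} f≤g = +-mono-≤ (f≤g zero) (∑-mono (f≤g ∘ suc))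

∑-const : ∀ n c → ∑ {n} (λ _ → c) ≡ n * c
∑-const zero    c = refl
∑-const (suc n) c = cong (c +_) (∑-const n c)

term≤∑ : (f : Fin n → ℕ) (i : Fin n) → f i ≤ ∑ f
term≤∑ f zero    = m≤m+n _ _
term≤∑ f (suc i) = ≤-trans (term≤∑ (f ∘ suc) i) (m≤n+m _ _)

𝟙 : Bool → ℕ
𝟙 true  = 1
𝟙 false = 0

𝟙≤1 : ∀ b → 𝟙 b ≤ 1
𝟙≤1 true  = ≤-refl
𝟙≤1 false = z≤n

count : (Fin n → Bool) → ℕ
count N = ∑ (𝟙 ∘ N)

δ : Fin n → Fin n → ℕ
δ a j = 𝟙 (does (a ≟ j))

δ-refl : (a : Fin n) → δ a a ≡ 1
δ-refl a = cong 𝟙 (dec-true (a ≟ a) refl)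

δ-≢ : {a j : Fin n} → a ≢ j → δ a j ≡ 0
δ-≢ {a = a} {j} a≢j = cong 𝟙 (dec-false (a ≟ j) a≢j)

∑-δ : (a : Fin n) → ∑ (δ a) ≡ 1
∑-δ {suc n} zero    = cong suc (trans (∑-const n 0) (*-zeroʳ n))
∑-δ {suc n} (suc a) = ∑-δ a

∑-+δ : (f : Fin n → ℕ) (a : Fin n) → ∑ (λ j → f j + δ a j) ≡ ∑ f + 1
∑-+δ f a = trans (∑-distrib-+ f (δ a)) (cong (∑ f +_) (∑-δ a))

count-∧≟ : ∀ b (a : Fin n) → count (λ j → b ∧ does (a ≟ j)) ≡ 𝟙 b
count-∧≟ true  a = ∑-δ a
count-∧≟ {n} false a = trans (∑-const n 0) (*-zeroʳ n)

count-true : ∀ n → count {n} (const true) ≡ n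
count-true n = trans (∑-const n 1) (*-identityʳ n)

count+count-not : (N : Fin n → Bool) → count N + count (not ∘ N) ≡ n
count+count-not {n} N = begin
  count N + count (not ∘ N)               ≡⟨ ∑-distrib-+ (𝟙 ∘ N) (𝟙 ∘ not ∘ N) ⟨
  ∑ (λ j → 𝟙 (N j) + 𝟙 (not (N j)))       ≡⟨ sum-cong-≗ (λ j → one (N j)) ⟩
  count {n} (const true)                  ≡⟨ count-true n ⟩
  n                                       ∎
  where
  open ≡-Reasoning
  one : ∀ b → 𝟙 b + 𝟙 (not b) ≡ 1
  one true  = refl
  one false = refl

infixl 6 _─_
_─_ : (Fin n → Bool) → Fin n → (Fin n → Bool)
(N ─ a) j = N j ∧ not (does (a ≟ j))

─-true : (N : Fin n → Bool) {a j : Fin n} → (N ─ a) j ≡ true → N j ≡ true × a ≢ j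
─-true N {a} {j} e with N j | a ≟ j
─-true N {a} {j} () | true  | yes _
─-true N {a} {j} e  | true  | no a≢j = refl , a≢j

─-intro : (N : Fin n → Bool) {a j : Fin n} → N j ≡ true → a ≢ j → (N ─ a) j ≡ true
─-intro N {a} {j} e a≢j rewrite e | dec-false (a ≟ j) a≢j = refl

-- The first summand has `N a` in place of `N j`: that factor is then constant, and `count-∧≟` sums
-- it.
𝟙-split : (N : Fin n → Bool) (a j : Fin n) →
          𝟙 (N j) ≡ 𝟙 (N a ∧ does (a ≟ j)) + 𝟙 ((N ─ a) j)
𝟙-split N a j with a ≟ j
... | yes refl with N a
...   | true  = refl
...   | false = refl
𝟙-split N a j | no _ with N a | N j
... | true  | true  = refl
... | true  | false = refl
... | false | true  = refl
... | false | false = refl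

count-split : (N : Fin n → Bool) (a : Fin n) → count N ≡ 𝟙 (N a) + count (N ─ a)
count-split N a = begin
  count N                                                   ≡⟨ sum-cong-≗ (𝟙-split N a) ⟩
  ∑ (λ j → 𝟙 (N a ∧ does (a ≟ j)) + 𝟙 ((N ─ a) j))          ≡⟨ ∑-distrib-+ (λ j → 𝟙 (N a ∧ does (a ≟ j))) (𝟙 ∘ (N ─ a)) ⟩
  count (λ j → N a ∧ does (a ≟ j)) + count (N ─ a)          ≡⟨ cong (_+ count (N ─ a)) (count-∧≟ (N a) a) ⟩
  𝟙 (N a) + count (N ─ a)                                   ∎
  where open ≡-Reasoning

count>0⇒∃ : (N : Fin n → Bool) → 0 < count N → ∃[ j ] N j ≡ true
count>0⇒∃ {suc n} N 0<c with N zero in eq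
... | true  = zero , eq
... | false with count>0⇒∃ (N ∘ suc) 0<c
...   | j , e = suc j , e

-- Pigeonhole: striking the entries of `L` from `N` one at a time lowers the count by at most one
-- each.
fresh : (N : Fin n → Bool) (L : List (Fin n)) → length L < count N →
        ∃[ j ] N j ≡ true × j ∉ L
fresh N []      L< with count>0⇒∃ N L<
... | j , e = j , e , λ ()
fresh N (a ∷ L) L< with fresh (N ─ a) L (+-cancelˡ-≤ 1 _ _ (begin
    suc (suc (length L))      ≤⟨ L< ⟩
    count N                   ≡⟨ count-split N a ⟩
    𝟙 (N a) + count (N ─ a)   ≤⟨ +-mono-≤ (𝟙≤1 (N a)) ≤-refl ⟩
    1 + count (N ─ a)         ∎))
  where
  open ≤-Reasoning
... | j , e , j∉L with ─-true N e
...   | e′ , a≢j = j , e′ , λ { (here j≡a) → a≢j (sym j≡a) ; (there j∈L) → j∉L j∈L }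

fresh-vertex : (L : List (Fin n)) → length L < n → ∃[ j ] j ∉ L
fresh-vertex {n} L L<n with fresh (const true) L (subst (length L <_) (sym (count-true n)) L<n)
... | j , _ , j∉L = j , j∉L

unique⇒length≤count : (N : Fin n → Bool) {L : List (Fin n)} → AllPairs _≢_ L →
                      All (λ j → N j ≡ true) L → length L ≤ count N
unique⇒length≤count N []       []       = z≤n
unique⇒length≤count N {a ∷ L} (a∉ ∷ u) (e ∷ es) =
  subst (suc (length L) ≤_) (sym (trans (count-split N a) (cong (λ b → 𝟙 b + count (N ─ a)) e)))
    (s≤s (unique⇒length≤count (N ─ a) u
      (All.zipWith (λ (e , a≢j) → ─-intro N e a≢j) (es , a∉))))

-- The last component writes the indicator of `N` as a sum of unit vectors, which can be regrouped
-- inside degree equations.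
enumerate : (N : Fin n → Bool) → count N ≡ k →
            ∃[ e ] Injective {A = Fin k} _≡_ _≡_ e × (∀ i → N (e i) ≡ true) ×
                   (∀ j → 𝟙 (N j) ≡ ∑ (λ i → δ (e i) j))
enumerate {k = zero} N c≡0 =
  (λ ()) , (λ { {()} }) , (λ ()) , λ j → n≤0⇒n≡0 (subst (𝟙 (N j) ≤_) c≡0 (term≤∑ (𝟙 ∘ N) j))
enumerate {n} {suc k} N c≡ with count>0⇒∃ N (subst (0 <_) (sym c≡) (s≤s z≤n))
... | x , Nx with enumerate (N ─ x)
                    (suc-injective (trans (sym (trans (count-split N x)
                       (cong (λ b → 𝟙 b + count (N ─ x)) Nx))) c≡))
...   | e , e-inj , e-true , e-sum = e′ , inj , tr , sm
  where
  e′ : Fin (suc k) → Fin n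
  e′ zero    = x
  e′ (suc i) = e i
  x≢e : ∀ i → x ≢ e i
  x≢e i = proj₂ (─-true N {x} (e-true i))
  inj : Injective _≡_ _≡_ e′
  inj {zero}  {zero}  _ = refl
  inj {zero}  {suc j} p = contradiction p (x≢e j)
  inj {suc i} {zero}  p = contradiction (sym p) (x≢e i)
  inj {suc i} {suc j} p = cong suc (e-inj p)
  tr : ∀ i → N (e′ i) ≡ true
  tr zero    = Nx
  tr (suc i) = proj₁ (─-true N {x} (e-true i))
  sm : ∀ j → 𝟙 (N j) ≡ ∑ (λ i → δ (e′ i) j)
  sm j = begin
    𝟙 (N j)                                  ≡⟨ 𝟙-split N x j ⟩
    𝟙 (N x ∧ does (x ≟ j)) + 𝟙 ((N ─ x) j)   ≡⟨ cong₂ _+_ (cong (λ b → 𝟙 (b ∧ does (x ≟ j))) Nx) (e-sum j) ⟩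
    δ x j + ∑ (λ i → δ (e i) j)              ∎
    where open ≡-Reasoning

-- Graphs and degrees

deg : Graph n → Fin n → ℕ
deg G v = count (adj G v)

degree≡deg : (G : Graph n) (v : Fin n) → degree G v ≡ deg G v
degree≡deg G v = go (adj G v)
  where
  go : ∀ {n} (N : Fin n → Bool) → ∣ tabulate N ∣ ≡ count N
  go {zero}  N = refl
  go {suc n} N with N zero
  ... | true  = cong suc (go (N ∘ suc))
  ... | false = go (N ∘ suc)

Adj : Graph n → Fin n → Fin n → Set
Adj G u v = adj G u v ≡ true

Adj? : (G : Graph n) (u v : Fin n) → Adj G u v ⊎ adj G u v ≡ false
Adj? G u v with adj G u v
... | true  = inj₁ refl
... | false = inj₂ refl

Adj-sym : (G : Graph n) {u v : Fin n} → Adj G u v → Adj G v u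
Adj-sym G {u} {v} = trans (adj-sym G v u)

true≢false : {b : Bool} → b ≡ true → b ≢ false
true≢false refl ()

Adj⇒≢ : (G : Graph n) {u v : Fin n} → Adj G u v → u ≢ v
Adj⇒≢ G {u} u~u refl = true≢false u~u (adj-irrefl G u)

deg<n : (G : Graph n) (v : Fin n) → deg G v < n
deg<n {n} G v = begin-strict
  deg G v                                  <⟨ m<m+n _ (unique⇒length≤count (not ∘ adj G v) ([] ∷ []) (cong not (adj-irrefl G v) ∷ [])) ⟩
  deg G v + count (not ∘ adj G v)          ≡⟨ count+count-not (adj G v) ⟩
  n                                        ∎
  where
  open ≤-Reasoning

-- Adding and deleting edges and vertices

-- Overwrites the pair with `β` whatever stood there, so that one construction serves both for
-- adding and for deleting an edge.
setEdge : (G : Graph n) {a b : Fin n} → a ≢ b → Bool → Graph n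
setEdge {n} G {a} {b} a≢b β = record
  { adj        = λ u w → if on u w then β else adj G u w
  ; adj-sym    = λ u w → cong₂ (if_then β else_) (on-sym u w) (adj-sym G u w)
  ; adj-irrefl = λ u → trans (cong (if_then β else adj G u u) (on-irrefl u)) (adj-irrefl G u)
  }
  where
  on : Fin n → Fin n → Bool
  on u w = (does (a ≟ u) ∧ does (b ≟ w)) ∨ (does (b ≟ u) ∧ does (a ≟ w))
  on-sym : ∀ u w → on u w ≡ on w u
  on-sym u w = trans (∨-comm (does (a ≟ u) ∧ does (b ≟ w)) _)
    (cong₂ _∨_ (∧-comm (does (b ≟ u)) _) (∧-comm (does (a ≟ u)) _))
  on-irrefl : ∀ u → on u u ≡ false
  on-irrefl u with a ≟ u | b ≟ u
  ... | yes refl | yes refl = contradiction refl a≢b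
  ... | yes _    | no _     = refl
  ... | no _     | yes _    = refl
  ... | no _     | no _     = refl

-- By `setEdge-same` one of the two graphs agrees with `G`; `addEdge-deg` and `removeEdge-deg` are
-- the two readings of this identity.
setEdge-deg : (G : Graph n) {a b : Fin n} (a≢b : a ≢ b) (j : Fin n) →
              deg (setEdge G a≢b true) j ≡ deg (setEdge G a≢b false) j + (δ a j + δ b j)
setEdge-deg G {a} {b} a≢b j = begin
  deg (setEdge G a≢b true) j
    ≡⟨ sum-cong-≗ pointwise ⟩
  ∑ (λ w → 𝟙 (adj (setEdge G a≢b false) j w) + (f w + g w))
    ≡⟨ ∑-distrib-+ (λ w → 𝟙 (adj (setEdge G a≢b false) j w)) (λ w → f w + g w) ⟩
  deg (setEdge G a≢b false) j + ∑ (λ w → f w + g w)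
    ≡⟨ cong (deg (setEdge G a≢b false) j +_) (∑-distrib-+ f g) ⟩
  deg (setEdge G a≢b false) j + (∑ f + ∑ g)
    ≡⟨ cong (deg (setEdge G a≢b false) j +_) (cong₂ _+_ (count-∧≟ (does (a ≟ j)) b) (count-∧≟ (does (b ≟ j)) a)) ⟩
  deg (setEdge G a≢b false) j + (δ a j + δ b j)
    ∎
  where
  open ≡-Reasoning
  f = λ w → 𝟙 (does (a ≟ j) ∧ does (b ≟ w))
  g = λ w → 𝟙 (does (b ≟ j) ∧ does (a ≟ w))
  pointwise : ∀ w → 𝟙 (adj (setEdge G a≢b true) j w) ≡
                    𝟙 (adj (setEdge G a≢b false) j w) + (f w + g w)
  pointwise w with a ≟ j | b ≟ j
  ... | yes refl | yes refl = contradiction refl a≢b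
  ... | no _     | no _     = sym (+-identityʳ _)
  ... | yes _    | no _ with does (b ≟ w)
  ...   | true  = refl
  ...   | false = sym (+-identityʳ _)
  pointwise w | no _ | yes _ with does (a ≟ w)
  ...   | true  = refl
  ...   | false = sym (+-identityʳ _)

setEdge-same : (G : Graph n) {a b : Fin n} (a≢b : a ≢ b) {β : Bool} → adj G a b ≡ β →
               ∀ u w → adj (setEdge G a≢b β) u w ≡ adj G u w
setEdge-same G {a} {b} a≢b e u w with a ≟ u | b ≟ w | b ≟ u | a ≟ w
... | yes refl | yes refl | _        | _        = sym e
... | yes _    | no _     | yes refl | yes refl = trans (sym e) (adj-sym G a b)
... | yes _    | no _     | yes _    | no _     = refl
... | yes _    | no _     | no _     | _        = refl
... | no _     | _        | yes refl | yes refl = trans (sym e) (adj-sym G a b)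
... | no _     | _        | yes _    | no _     = refl
... | no _     | _        | no _     | _        = refl

addEdge-deg : (G : Graph n) {a b : Fin n} (a≢b : a ≢ b) → adj G a b ≡ false → ∀ j →
              deg (setEdge G a≢b true) j ≡ deg G j + (δ a j + δ b j)
addEdge-deg G {a} {b} a≢b e j = trans (setEdge-deg G a≢b j)
  (cong (_+ (δ a j + δ b j)) (sum-cong-≗ (λ w → cong 𝟙 (setEdge-same G a≢b e j w))))

removeEdge-deg : (G : Graph n) {a b : Fin n} (a≢b : a ≢ b) → Adj G a b → ∀ j →
                 deg G j ≡ deg (setEdge G a≢b false) j + (δ a j + δ b j)
removeEdge-deg G a≢b e j = trans
  (sum-cong-≗ (λ w → cong 𝟙 (sym (setEdge-same G a≢b e j w)))) (setEdge-deg G a≢b j)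

setEdge-off : (G : Graph n) {a b : Fin n} (a≢b : a ≢ b) {β : Bool} {u w : Fin n} →
              u ≢ a → u ≢ b → adj (setEdge G a≢b β) u w ≡ adj G u w
setEdge-off G {a} {b} a≢b {u = u} u≢a u≢b
  rewrite dec-false (a ≟ u) (≢-sym u≢a) | dec-false (b ≟ u) (≢-sym u≢b) = refl

setEdge-offʳ : (G : Graph n) {a b : Fin n} (a≢b : a ≢ b) {β : Bool} {u w : Fin n} →
               w ≢ a → w ≢ b → adj (setEdge G a≢b β) u w ≡ adj G u w
setEdge-offʳ G a≢b {β} {u} {w} w≢a w≢b =
  trans (adj-sym (setEdge G a≢b β) u w) (trans (setEdge-off G a≢b w≢a w≢b) (adj-sym G w u))

data View (v : Fin (suc n)) : Fin (suc n) → Set where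
  itself : View v v
  other  : ∀ j → View v (punchIn v j)

view : (v w : Fin (suc n)) → View v w
view v w with v ≟ w
... | yes refl = itself
... | no v≢w   = subst (View v) (punchIn-punchOut v≢w) (other (punchOut v≢w))

infixl 6 _∖_
_∖_ : Graph (suc n) → Fin (suc n) → Graph n
G ∖ v = record
  { adj        = λ i j → adj G (punchIn v i) (punchIn v j)
  ; adj-sym    = λ i j → adj-sym G _ _
  ; adj-irrefl = λ i → adj-irrefl G _
  }

nbr : Graph (suc n) → Fin (suc n) → Fin n → Bool
nbr G v j = adj G v (punchIn v j)

deg-self : (G : Graph (suc n)) (v : Fin (suc n)) → deg G v ≡ count (nbr G v)
deg-self G v = trans (sum-remove {i = v} (𝟙 ∘ adj G v))
  (cong (λ b → 𝟙 b + count (nbr G v)) (adj-irrefl G v))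

deg-punchIn : (G : Graph (suc n)) (v : Fin (suc n)) (j : Fin n) →
              deg G (punchIn v j) ≡ 𝟙 (nbr G v j) + deg (G ∖ v) j
deg-punchIn G v j = trans (sum-remove {i = v} (𝟙 ∘ adj G (punchIn v j)))
  (cong (λ b → 𝟙 b + deg (G ∖ v) j) (adj-sym G (punchIn v j) v))

degSum : Graph n → ℕ
degSum G = ∑ (deg G)

degSum-∖ : (G : Graph (suc n)) (v : Fin (suc n)) →
           degSum G ≡ degSum (G ∖ v) + (deg G v + deg G v)
degSum-∖ G v = begin
  degSum G                                              ≡⟨ sum-remove {i = v} (deg G) ⟩
  deg G v + ∑ (deg G ∘ punchIn v)                       ≡⟨ cong (deg G v +_) (sum-cong-≗ (deg-punchIn G v)) ⟩
  deg G v + ∑ (λ j → 𝟙 (nbr G v j) + deg (G ∖ v) j)     ≡⟨ cong (deg G v +_) (∑-distrib-+ (𝟙 ∘ nbr G v) (deg (G ∖ v))) ⟩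
  deg G v + (count (nbr G v) + degSum (G ∖ v))          ≡⟨ cong (λ d → deg G v + (d + degSum (G ∖ v))) (sym (deg-self G v)) ⟩
  deg G v + (deg G v + degSum (G ∖ v))                  ≡⟨ lemma (deg G v) (degSum (G ∖ v)) ⟩
  degSum (G ∖ v) + (deg G v + deg G v)                  ∎
  where
  open ≡-Reasoning
  lemma : ∀ d s → d + (d + s) ≡ s + (d + d)
  lemma = solve-∀

-- Handshake lemma: deleting a vertex lowers the degree sum by twice its degree.
degSum-even : (G : Graph n) → ∃[ h ] degSum G ≡ h + h
degSum-even {zero}  G = 0 , refl
degSum-even {suc n} G with degSum-even (G ∖ zero)
... | h , e = h + deg G zero , trans (degSum-∖ G zero) (trans (cong (_+ (deg G zero + deg G zero)) e) (lemma h (deg G zero)))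
  where
  lemma : ∀ h d → (h + h) + (d + d) ≡ (h + d) + (h + d)
  lemma = solve-∀

-- Undoes the deletion of a vertex. The outer `insertAt` acts on the second vertex of a pair and the
-- inner one on the first; `insertAt N v false` is the column of `v` itself.
extend : Graph n → Fin (suc n) → (Fin n → Bool) → Graph (suc n)
extend {n} H v N = record { adj = A ; adj-sym = s ; adj-irrefl = i }
  where
  A : Fin (suc n) → Fin (suc n) → Bool
  A u = insertAt (λ j → insertAt (λ k → adj H k j) v (N j) u) v (insertAt N v false u)
  s : ∀ u w → A u w ≡ A w u
  s u w with view v u | view v w
  ... | itself  | itself  = refl
  ... | itself  | other k
    rewrite insertAt-punchIn (λ j → insertAt (λ k → adj H k j) v (N j) v) v (insertAt N v false v) k
          | insertAt-lookup (λ j → adj H j k) v (N k)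
          | insertAt-lookup (λ j → insertAt (λ l → adj H l j) v (N j) (punchIn v k)) v (insertAt N v false (punchIn v k))
          | insertAt-punchIn N v false k = refl
  ... | other j | itself
    rewrite insertAt-punchIn (λ l → insertAt (λ k → adj H k l) v (N l) v) v (insertAt N v false v) j
          | insertAt-lookup (λ l → adj H l j) v (N j)
          | insertAt-lookup (λ l → insertAt (λ k → adj H k l) v (N l) (punchIn v j)) v (insertAt N v false (punchIn v j))
          | insertAt-punchIn N v false j = refl
  ... | other j | other k
    rewrite insertAt-punchIn (λ l → insertAt (λ k → adj H k l) v (N l) (punchIn v j)) v (insertAt N v false (punchIn v j)) k
          | insertAt-punchIn (λ l → adj H l k) v (N k) j
          | insertAt-punchIn (λ l → insertAt (λ k → adj H k l) v (N l) (punchIn v k)) v (insertAt N v false (punchIn v k)) j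
          | insertAt-punchIn (λ l → adj H l j) v (N j) k = adj-sym H j k
  i : ∀ u → A u u ≡ false
  i u with view v u
  ... | itself  = trans (insertAt-lookup _ v _) (insertAt-lookup N v false)
  ... | other j = trans (insertAt-punchIn _ v _ j) (trans (insertAt-punchIn _ v _ j) (adj-irrefl H j))

module _ (H : Graph n) (v : Fin (suc n)) (N : Fin n → Bool) where

  extend-nbr : ∀ j → nbr (extend H v N) v j ≡ N j
  extend-nbr j = trans (insertAt-punchIn _ v _ j) (insertAt-lookup _ v (N j))

  extend-∖ : ∀ i j → adj (extend H v N ∖ v) i j ≡ adj H i j
  extend-∖ i j = trans (insertAt-punchIn _ v _ j)
    (insertAt-punchIn _ v _ i)

  extend-deg-self : deg (extend H v N) v ≡ count N
  extend-deg-self = trans (deg-self (extend H v N) v) (sum-cong-≗ (cong 𝟙 ∘ extend-nbr))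

  extend-deg : ∀ j → deg (extend H v N) (punchIn v j) ≡ 𝟙 (N j) + deg H j
  extend-deg j = trans (deg-punchIn (extend H v N) v j)
    (cong₂ _+_ (cong 𝟙 (extend-nbr j)) (sum-cong-≗ (cong 𝟙 ∘ extend-∖ j)))

-- Books

record Book (G : Graph n) : Set where
  constructor book
  field
    {h h′ p q r} : Fin n
    h~h′ : Adj G h h′
    h~p : Adj G h p
    h~q : Adj G h q
    h~r : Adj G h r
    h′~p : Adj G h′ p
    h′~q : Adj G h′ q
    h′~r : Adj G h′ r
    -- The vertices of all other pairs are adjacent, hence distinct by `Adj⇒≢`.
    p≢q : p ≢ q
    p≢r : p ≢ r
    q≢r : q ≢ r

mapBook : {G : Graph m} {H : Graph n} (f : Fin m → Fin n) → Injective _≡_ _≡_ f →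
          (∀ {u w} → Adj G u w → Adj H (f u) (f w)) → Book G → Book H
mapBook f inj hom (book a b c d e f′ g x y z) =
  book (hom a) (hom b) (hom c) (hom d) (hom e) (hom f′) (hom g) (x ∘ inj) (y ∘ inj) (z ∘ inj)

swap-hubs : {G : Graph n} → Book G → Book G
swap-hubs {G = G} (book h~h′ h~p h~q h~r h′~p h′~q h′~r p≢q p≢r q≢r) =
  book (Adj-sym G h~h′) h′~p h′~q h′~r h~p h~q h~r p≢q p≢r q≢r

-- Degrees agree vertex by vertex, not merely as a multiset, so that a deleted vertex can be
-- attached again at known places.
Potentially : Graph n → Set
Potentially {n} G = ∃[ G′ ] (∀ j → deg {n} G′ j ≡ deg G j) × Book G′

-- The common end of all reductions that delete `v`: the book of `H` survives in the extension, and
-- only the degrees have to be balanced.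
potentially-extend : (G : Graph (suc n)) (v : Fin (suc n)) (H : Graph n) (N : Fin n → Bool) →
  count N ≡ deg G v → (∀ j → 𝟙 (N j) + deg H j ≡ deg G (punchIn v j)) → Book H → Potentially G
potentially-extend {n} G v H N N≡ H≡ B = extend H v N , degs ,
  mapBook (punchIn v) (λ {i} {j} → punchIn-injective v i j) (λ {u} {w} → trans (extend-∖ H v N u w)) B
  where
  degs : ∀ w → deg (extend H v N) w ≡ deg G w
  degs w with view v w
  ... | itself  = trans (extend-deg-self H v N) N≡
  ... | other j = trans (extend-deg H v N j) (H≡ j)

-- Degree-3 vertices

-- The last component expresses that `s`, `t`, `c` exhaust `Fin 3`, in the form that matches the sum
-- from `enumerate`.
third : {s t : Fin 3} → s ≢ t →
        ∃[ c ] s ≢ c × t ≢ c × (∀ (f : Fin 3 → ℕ) → f s + f t + f c ≡ ∑ f)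
third {0F} {0F} s≢t = contradiction refl s≢t
third {0F} {1F} _   = 2F , (λ ()) , (λ ()) , λ f → lemma (f 0F) (f 1F) (f 2F)
  where
  lemma : ∀ x y z → x + y + z ≡ x + (y + (z + 0))
  lemma = solve-∀
third {0F} {2F} _   = 1F , (λ ()) , (λ ()) , λ f → lemma (f 0F) (f 1F) (f 2F)
  where
  lemma : ∀ x y z → x + z + y ≡ x + (y + (z + 0))
  lemma = solve-∀
third {1F} {0F} _   = 2F , (λ ()) , (λ ()) , λ f → lemma (f 0F) (f 1F) (f 2F)
  where
  lemma : ∀ x y z → y + x + z ≡ x + (y + (z + 0))
  lemma = solve-∀
third {1F} {1F} s≢t = contradiction refl s≢t
third {1F} {2F} _   = 0F , (λ ()) , (λ ()) , λ f → lemma (f 0F) (f 1F) (f 2F)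
  where
  lemma : ∀ x y z → y + z + x ≡ x + (y + (z + 0))
  lemma = solve-∀
third {2F} {0F} _   = 1F , (λ ()) , (λ ()) , λ f → lemma (f 0F) (f 1F) (f 2F)
  where
  lemma : ∀ x y z → z + x + y ≡ x + (y + (z + 0))
  lemma = solve-∀
third {2F} {1F} _   = 0F , (λ ()) , (λ ()) , λ f → lemma (f 0F) (f 1F) (f 2F)
  where
  lemma : ∀ x y z → z + y + x ≡ x + (y + (z + 0))
  lemma = solve-∀
third {2F} {2F} s≢t = contradiction refl s≢t

-- Two 2-element subsets of a 3-element set have distinct representatives. This chooses the new
-- edges in `augment-along`.
distinct-avoiding : (i j : Fin 3) → ∃[ s ] ∃[ t ] i ≢ s × j ≢ t × s ≢ t
distinct-avoiding = from-yes (all? {n = 3} λ i → all? λ j → any? λ s → any? λ t →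
  ¬? (i ≟ s) ×-dec ¬? (j ≟ t) ×-dec ¬? (s ≟ t))

module _ (G : Graph (suc m)) (v : Fin (suc m)) (3≤deg : ∀ w → 3 ≤ deg G w) (4≤m : 4 ≤ m)
  (e : Fin 3 → Fin m) (e-inj : Injective _≡_ _≡_ e) (e-nbr : ∀ i → nbr G v (e i) ≡ true)
  (e-all : ∀ j → 𝟙 (nbr G v j) ≡ ∑ (λ i → δ (e i) j))
  where

  private
    Q : Graph m
    Q = G ∖ v

    -- Counting one at all three neighbours of `v` and discounting `e c`, the degrees of `Q` are
    -- raised by one at the other two. The vertex `e c` is the z of the overview.
    Augmented : Set
    Augmented = ∃[ R ] ∃[ c ] ∀ j → deg {m} R j + δ (e c) j ≡ deg Q j + 𝟙 (nbr G v j)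

    e-≢ : ∀ {i j} → i ≢ j → e i ≢ e j
    e-≢ i≢j = i≢j ∘ e-inj

    third-sum : ∀ {s t} (s≢t : s ≢ t) j →
                δ (e s) j + δ (e t) j + δ (e (proj₁ (third s≢t))) j ≡ 𝟙 (nbr G v j)
    third-sum s≢t j =
      trans (proj₂ (proj₂ (proj₂ (third s≢t))) (λ i → δ (e i) j)) (sym (e-all j))

    join : ∀ {s t} → s ≢ t → adj Q (e s) (e t) ≡ false → Augmented
    join {s} {t} s≢t s≁t = setEdge Q (e-≢ s≢t) true , proj₁ (third s≢t) , λ j → begin
      deg (setEdge Q (e-≢ s≢t) true) j + δ (e (proj₁ (third s≢t))) j
        ≡⟨ cong (_+ δ (e (proj₁ (third s≢t))) j) (addEdge-deg Q (e-≢ s≢t) s≁t j) ⟩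
      deg Q j + (δ (e s) j + δ (e t) j) + δ (e (proj₁ (third s≢t))) j
        ≡⟨ +-assoc (deg Q j) _ _ ⟩
      deg Q j + (δ (e s) j + δ (e t) j + δ (e (proj₁ (third s≢t))) j)
        ≡⟨ cong (deg Q j +_) (third-sum s≢t j) ⟩
      deg Q j + 𝟙 (nbr G v j)
        ∎
      where open ≡-Reasoning

    -- Replaces the edge `pq` by edges from `p` to `e s` and from `q` to `e t`: `p` and `q` keep
    -- their degrees, while `e s` and `e t` gain one each.
    switch : ∀ {s t p q} → s ≢ t → (∀ i → p ≢ e i) → (∀ i → q ≢ e i) → Adj Q p q →
             adj Q p (e s) ≡ false → adj Q q (e t) ≡ false → Augmented
    switch {s} {t} {p} {q} s≢t p∉e q∉e p~q p≁s q≁t = Q₃ , c , λ j → begin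
        deg Q₃ j + δ (e c) j
          ≡⟨ cong (_+ δ (e c) j) (addEdge-deg Q₂ (q∉e t) q≁₂t j) ⟩
        deg Q₂ j + (δ q j + δ (e t) j) + δ (e c) j
          ≡⟨ cong (λ d → d + (δ q j + δ (e t) j) + δ (e c) j) (addEdge-deg Q₁ (p∉e s) p≁₁s j) ⟩
        deg Q₁ j + (δ p j + δ (e s) j) + (δ q j + δ (e t) j) + δ (e c) j
          ≡⟨ lemma (deg Q₁ j) (δ p j) (δ q j) (δ (e s) j) (δ (e t) j) (δ (e c) j) ⟩
        deg Q₁ j + (δ p j + δ q j) + (δ (e s) j + δ (e t) j + δ (e c) j)
          ≡⟨ cong₂ _+_ (sym (removeEdge-deg Q p≢q p~q j)) (third-sum s≢t j) ⟩
        deg Q j + 𝟙 (nbr G v j)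
          ∎
      where
      open ≡-Reasoning
      c = proj₁ (third s≢t)
      p≢q = Adj⇒≢ Q p~q
      Q₁ = setEdge Q p≢q false
      p≁₁s : adj Q₁ p (e s) ≡ false
      p≁₁s = trans (setEdge-offʳ Q p≢q (≢-sym (p∉e s)) (≢-sym (q∉e s))) p≁s
      Q₂ = setEdge Q₁ (p∉e s) true
      q≁₂t : adj Q₂ q (e t) ≡ false
      q≁₂t = trans (setEdge-off Q₁ (p∉e s) (≢-sym p≢q) (q∉e s))
             (trans (setEdge-offʳ Q p≢q (≢-sym (p∉e t)) (≢-sym (q∉e t))) q≁t)
      Q₃ = setEdge Q₂ (q∉e t) true
      lemma : ∀ d a b x y z → d + (a + x) + (b + y) + z ≡ d + (a + b) + (x + y + z)
      lemma = solve-∀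

    module _ (clique : ∀ {i j} → i ≢ j → Adj Q (e i) (e j)) where

      -- The hubs are `e s` and `e t`; the pages are `v`, the third neighbour of `v`, and `p`.
      common-neighbour : ∀ {p s t} → s ≢ t → (∀ i → p ≢ e i) →
                         Adj Q p (e s) → Adj Q p (e t) → Book G
      common-neighbour {p} {s} {t} s≢t p∉e p~s p~t with third s≢t
      ... | c , s≢c , t≢c , _ = book {p = v} {q = punchIn v (e c)} {r = punchIn v p}
        (clique s≢t)
        (Adj-sym G (e-nbr s)) (clique s≢c) (Adj-sym Q p~s)
        (Adj-sym G (e-nbr t)) (clique t≢c) (Adj-sym Q p~t)
        (≢-sym (punchInᵢ≢i v (e c))) (≢-sym (punchInᵢ≢i v p))
        (p∉e c ∘ sym ∘ punchIn-injective v (e c) p)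

      few-neighbours : ∀ {p} → (∀ i → p ≢ e i) →
                       Book G ⊎ ∃[ i ] (∀ {j} → i ≢ j → adj Q p (e j) ≡ false)
      few-neighbours {p} p∉e with any? (λ i → adj Q p (e i) ≟ᵇ true)
      -- If `p` has no neighbour among the three, any index will do as the exceptional one.
      ... | no none = inj₂ (0F , λ {j} _ → ¬-not (λ p~j → none (j , p~j)))
      ... | yes (i , p~i) with any? (λ j → ¬? (i ≟ j) ×-dec (adj Q p (e j) ≟ᵇ true))
      ...   | yes (j , i≢j , p~j) = inj₁ (common-neighbour i≢j p∉e p~i p~j)
      ...   | no none = inj₂ (i , λ {j} i≢j → ¬-not (λ p~j → none (j , i≢j , p~j)))

      -- Among the three neighbours of `v`, the only possible neighbour of `p` is `e i`, so `q` lies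
      -- outside them too. Unless there is a book, `p` and `q` each miss at least two of the three,
      -- and the edge `pq` can be switched.
      augment-along : ∀ {p q i} → (∀ j → p ≢ e j) → Adj Q p q → q ≢ e i →
                      (∀ {j} → i ≢ j → adj Q p (e j) ≡ false) → Book G ⊎ Augmented
      augment-along {p} {q} {i} p∉e p~q q≢eᵢ p≁ = case few-neighbours q∉e of λ where
          (inj₁ B)        → inj₁ B
          (inj₂ (j , q≁)) → case distinct-avoiding i j of λ where
            (s , t , i≢s , j≢t , s≢t) → inj₂ (switch s≢t p∉e q∉e p~q (p≁ i≢s) (q≁ j≢t))
        where
        q∉e : ∀ j → q ≢ e j
        q∉e j refl with i ≟ j
        ... | yes refl = q≢eᵢ refl
        ... | no i≢j   = true≢false p~q (p≁ i≢j)

      -- As `p` is not joined to `v`, it keeps its degree of at least 3 in `Q` and so has a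
      -- neighbour other than `e i`.
      augment-at : ∀ {p} → (∀ i → p ≢ e i) → Book G ⊎ Augmented
      augment-at {p} p∉e = case few-neighbours p∉e of λ where
          (inj₁ B)        → inj₁ B
          (inj₂ (i , p≁)) →
            case fresh (adj Q p) (e i ∷ []) (≤-trans (s≤s (s≤s z≤n)) 3≤degQ) of λ where
              (q , p~q , q∉) → augment-along p∉e p~q (q∉ ∘ here) p≁
        where
        3≤degQ : 3 ≤ deg Q p
        3≤degQ = subst (3 ≤_) (trans (deg-punchIn G v p) (cong (_+ deg Q p) (trans (e-all p)
          (cong₂ _+_ (δ-≢ (≢-sym (p∉e 0F))) (cong₂ _+_ (δ-≢ (≢-sym (p∉e 1F)))
            (cong (_+ 0) (δ-≢ (≢-sym (p∉e 2F)))))))))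
          (3≤deg (punchIn v p))

      augment-clique : Book G ⊎ Augmented
      augment-clique = case fresh-vertex (e 0F ∷ e 1F ∷ e 2F ∷ []) 4≤m of λ where
        (p , p∉) → augment-at {p} λ where
          0F → p∉ ∘ here
          1F → p∉ ∘ there ∘ here
          2F → p∉ ∘ there ∘ there ∘ here

  augment : Book G ⊎ Augmented
  augment with any? (λ s → any? (λ t → ¬? (s ≟ t) ×-dec (adj Q (e s) (e t) ≟ᵇ false)))
  ... | yes (s , t , s≢t , s≁t) = inj₂ (join s≢t s≁t)
  ... | no none = augment-clique (λ {i} {j} i≢j → ¬-not (λ i≁j → none (i , j , i≢j , i≁j)))

-- Edges that can be deleted without destroying all books

_∈?_ : (j : Fin n) (L : List (Fin n)) → Dec (j ∈ L)
_∈?_ = DecMembership._∈?_ _≟_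

setEdge-off₁ : (G : Graph n) {a b : Fin n} (a≢b : a ≢ b) {β : Bool} {u w : Fin n} →
               u ≢ a → w ≢ a → adj (setEdge G a≢b β) u w ≡ adj G u w
setEdge-off₁ G {a} {b} a≢b {u = u} {w} u≢a w≢a
  rewrite dec-false (a ≟ u) (≢-sym u≢a) | dec-false (a ≟ w) (≢-sym w≢a)
        | ∧-zeroʳ (does (b ≟ u)) = refl

hubs vertices : {G : Graph n} → Book G → List (Fin n)
hubs     B = Book.h B ∷ Book.h′ B ∷ []
vertices B = Book.h B ∷ Book.h′ B ∷ Book.p B ∷ Book.q B ∷ Book.r B ∷ []

-- Every edge of a book meets a hub, so the deleted edge is not one of them.
remove-nonhub : {G : Graph n} (B : Book G) {a b : Fin n} (a≢b : a ≢ b) →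
                a ∉ hubs B → b ∉ hubs B → Book (setEdge G a≢b false)
remove-nonhub {G = G} (book {h = h} {h′} h~h′ h~p h~q h~r h′~p h′~q h′~r p≢q p≢r q≢r) {a} {b} a≢b a∉ b∉ =
  book (H h~h′) (H h~p) (H h~q) (H h~r) (H′ h′~p) (H′ h′~q) (H′ h′~r) p≢q p≢r q≢r
  where
  H : ∀ {w} → Adj G h w → Adj (setEdge G a≢b false) h w
  H = trans (setEdge-off G a≢b (a∉ ∘ here ∘ sym) (b∉ ∘ here ∘ sym))
  H′ : ∀ {w} → Adj G h′ w → Adj (setEdge G a≢b false) h′ w
  H′ = trans (setEdge-off G a≢b (a∉ ∘ there ∘ here ∘ sym) (b∉ ∘ there ∘ here ∘ sym))

remove-outside : {G : Graph n} (B : Book G) {a b : Fin n} (a≢b : a ≢ b) →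
                 a ∉ vertices B → Book (setEdge G a≢b false)
remove-outside {G = G} (book {h} {h′} {p} {q} {r} h~h′ h~p h~q h~r h′~p h′~q h′~r p≢q p≢r q≢r) {a} {b} a≢b a∉ =
  book (off h≢a h′≢a h~h′) (off h≢a p≢a h~p) (off h≢a q≢a h~q) (off h≢a r≢a h~r)
       (off h′≢a p≢a h′~p) (off h′≢a q≢a h′~q) (off h′≢a r≢a h′~r) p≢q p≢r q≢r
  where
  off : ∀ {u w} → u ≢ a → w ≢ a → Adj G u w → Adj (setEdge G a≢b false) u w
  off u≢a w≢a = trans (setEdge-off₁ G a≢b u≢a w≢a)
  h≢a : h ≢ a
  h≢a = a∉ ∘ here ∘ sym
  h′≢a : h′ ≢ a
  h′≢a = a∉ ∘ there ∘ here ∘ sym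
  p≢a : p ≢ a
  p≢a = a∉ ∘ there ∘ there ∘ here ∘ sym
  q≢a : q ≢ a
  q≢a = a∉ ∘ there ∘ there ∘ there ∘ here ∘ sym
  r≢a : r ≢ a
  r≢a = a∉ ∘ there ∘ there ∘ there ∘ there ∘ here ∘ sym

count≤length : (N : Fin n → Bool) (L : List (Fin n)) → (∀ j → N j ≡ true → j ∈ L) →
               count N ≤ length L
count≤length N L N⊆L with count N ≤? length L
... | yes c≤ = c≤
... | no c≰ with fresh N L (≰⇒> c≰)
...   | j , Nj , j∉L = contradiction (N⊆L j Nj) j∉L

-- Here `z` is the neighbour of `v` whose degree was not raised, which may have degree below 3. The
-- bound 4m - 2 on the degree sum is written without subtraction.
module _ (R : Graph m) (z : Fin m) (5≤m : 5 ≤ m) (3≤deg : ∀ {t} → t ≢ z → 3 ≤ deg R t)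
  (large : 4 * m ≤ degSum R + 2) where

  -- Both ends avoid `z` because `v` will be joined to `a`, `b` and `z`.
  Removable : Set
  Removable = ∃[ a ] ∃[ b ] ∃[ a≢b ] Adj R a b × a ≢ z × b ≢ z × Book (setEdge R {a} {b} a≢b false)

  private
    remove : ∀ {a b} → Adj R a b → a ≢ z → b ≢ z →
             ((a≢b : a ≢ b) → Book (setEdge R a≢b false)) → Removable
    remove a~b a≢z b≢z B = _ , _ , Adj⇒≢ R a~b , a~b , a≢z , b≢z , B (Adj⇒≢ R a~b)

    pair-∉ : ∀ {a b c : Fin m} → a ≢ b → a ≢ c → a ∉ b ∷ c ∷ []
    pair-∉ a≢b a≢c (here a≡b)         = a≢b a≡b
    pair-∉ a≢b a≢c (there (here a≡c)) = a≢c a≡c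

    -- With degree at least 3, `a` has a neighbour that is not a hub; the edge to it can go unless
    -- that neighbour is `z`. With degree at least 4 there is a further such neighbour besides `z`.
    nonhub : (B : Book R) → ∀ {a} → a ≢ z → a ∉ hubs B →
             Removable ⊎ (Adj R a z × z ∉ hubs B × deg R a ≤ 3)
    nonhub B {a} a≢z a∉ with fresh (adj R a) (hubs B) (3≤deg a≢z)
    ... | b , a~b , b∉ with b ≟ z
    ...   | no b≢z = inj₁ (remove a~b a≢z b≢z (λ a≢b → remove-nonhub B a≢b a∉ b∉))
    ...   | yes refl with deg R a ≤? 3
    ...     | yes d≤3 = inj₂ (a~b , b∉ , d≤3)
    ...     | no d≰3 with fresh (adj R a) (z ∷ hubs B) (≰⇒> d≰3)
    ...       | c , a~c , c∉ = inj₁ (remove a~c a≢z (c∉ ∘ here) (λ a≢c → remove-nonhub B a≢c a∉ (c∉ ∘ there)))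

    -- All edges outside the book meet z, which is joined to the pages only: too few edges.
    sparse : (B : Book R) → adj R z (Book.h B) ≡ false → adj R z (Book.h′ B) ≡ false →
             deg R (Book.p B) ≤ 3 → deg R (Book.q B) ≤ 3 → deg R (Book.r B) ≤ 3 → Removable
    sparse B z≁h z≁h′ dp dq dr with any? (λ t → ¬? (t ∈? (z ∷ vertices B)))
    -- Any edge at a vertex outside the book can go, provided that its other end is not `z`.
    ... | yes (t , t∉) with fresh (adj R t) (z ∷ []) (≤-trans (s≤s (s≤s z≤n)) (3≤deg (t∉ ∘ here)))
    ...   | b , t~b , b∉ = remove t~b (t∉ ∘ here) (b∉ ∘ here) (λ t≢b → remove-outside B t≢b (t∉ ∘ there))
    sparse B z≁h z≁h′ dp dq dr | no none = contradiction 5≤m (<⇒≱ (s≤s m≤4))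
      where
      open Book B
      cover : ∀ t → t ∈ z ∷ vertices B
      cover t = decidable-stable (t ∈? (z ∷ vertices B)) (λ t∉ → none (t , t∉))
      -- Here `x` is one hub and `y` the other; the neighbours of `x` lie among `y` and the three
      -- pages.
      hub-bound : ∀ {x y} → adj R x z ≡ false → (∀ {t} → Adj R x t → t ∈ hubs B → t ≡ y) →
                  deg R x ≤ 4
      hub-bound {x} {y} x≁z x-hubs = count≤length (adj R x) (y ∷ p ∷ q ∷ r ∷ []) (λ t x~t → go x~t (cover t))
        where
        go : ∀ {t} → Adj R x t → t ∈ z ∷ vertices B → t ∈ y ∷ p ∷ q ∷ r ∷ []
        go x~t (here refl)                = contradiction x≁z (true≢false x~t)
        go x~t (there (here refl))         = here (x-hubs x~t (here refl))
        go x~t (there (there (here refl))) = here (x-hubs x~t (there (here refl)))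
        go x~t (there (there (there t∈)))  = there t∈
      z-bound : deg R z ≤ 3
      z-bound = count≤length (adj R z) (p ∷ q ∷ r ∷ []) (λ t z~t → go z~t (cover t))
        where
        go : ∀ {t} → Adj R z t → t ∈ z ∷ vertices B → t ∈ p ∷ q ∷ r ∷ []
        go z~z (here refl)                 = contradiction refl (Adj⇒≢ R z~z)
        go z~h (there (here refl))         = contradiction z≁h (true≢false z~h)
        go z~h (there (there (here refl))) = contradiction z≁h′ (true≢false z~h)
        go _   (there (there (there t∈)))  = t∈
      slack : ∀ {t d} → d ≤ 3 → d ≤ 3 + δ h t + δ h′ t
      slack {t} d≤3 = ≤-trans d≤3 (≤-trans (m≤m+n 3 (δ h t)) (m≤m+n _ (δ h′ t)))
      bound : ∀ {t} → t ∈ z ∷ vertices B → deg R t ≤ 3 + δ h t + δ h′ t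
      bound (here refl) = slack z-bound
      bound (there (here refl)) = ≤-trans
        (hub-bound (trans (adj-sym R h z) z≁h)
          λ { h~h (here refl) → contradiction refl (Adj⇒≢ R h~h) ; _ (there (here refl)) → refl })
        (≤-trans (≤-reflexive (cong (3 +_) (sym (δ-refl h)))) (m≤m+n _ _))
      bound (there (there (here refl))) = ≤-trans
        (hub-bound (trans (adj-sym R h′ z) z≁h′)
          λ { _ (here refl) → refl ; h~h (there (here refl)) → contradiction refl (Adj⇒≢ R h~h) })
        (≤-trans (≤-reflexive (cong (3 +_) (sym (δ-refl h′)))) (+-mono-≤ (m≤m+n 3 (δ h h′)) ≤-refl))
      bound (there (there (there (here refl)))) = slack dp
      bound (there (there (there (there (here refl))))) = slack dq
      bound (there (there (there (there (there (here refl)))))) = slack dr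
      -- All degrees are at most 3, except for the two hubs with at most 4, so the degree sum is at
      -- most 3m + 2. It is also at least 4m - 2.
      m≤4 : m ≤ 4
      m≤4 = +-cancelʳ-≤ (m * 3) m 4 (begin
        m + m * 3                             ≡⟨ lemma₁ m ⟩
        4 * m                                 ≤⟨ large ⟩
        degSum R + 2                          ≤⟨ +-mono-≤ (∑-mono (bound ∘ cover)) ≤-refl ⟩
        ∑ (λ t → 3 + δ h t + δ h′ t) + 2      ≡⟨ cong (_+ 2) (trans (∑-+δ (λ t → 3 + δ h t) h′) (cong (_+ 1) (trans (∑-+δ (const 3) h) (cong (_+ 1) (∑-const m 3))))) ⟩
        m * 3 + 1 + 1 + 2                     ≡⟨ lemma₂ (m * 3) ⟩
        4 + m * 3                             ∎)
        where
        open ≤-Reasoning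
        lemma₁ : ∀ m → m + m * 3 ≡ 4 * m
        lemma₁ = solve-∀
        lemma₂ : ∀ t → t + 1 + 1 + 2 ≡ 4 + t
        lemma₂ = solve-∀

    ∉-hubs : (B : Book R) → ∀ {a} → Adj R (Book.h B) a → Adj R (Book.h′ B) a → a ∉ hubs B
    ∉-hubs B h~a h′~a = pair-∉ (≢-sym (Adj⇒≢ R h~a)) (≢-sym (Adj⇒≢ R h′~a))

    rotate : Book R → Book R
    rotate (book h~h′ h~p h~q h~r h′~p h′~q h′~r p≢q p≢r q≢r) =
      book h~h′ h~q h~r h~p h′~q h′~r h′~p q≢r (≢-sym p≢q) (≢-sym p≢r)

    -- If neither other page yields a removable edge, both are joined to `z`. Then `z` and `h′` are
    -- the hubs of a book with pages `q`, `r` and `h`, and the edge `hq` between two of its pages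
    -- can go.
    z-is-page : (B : Book R) → z ≡ Book.p B → Removable
    z-is-page B@(book {h} {h′} {q = q} {r} h~h′ h~p h~q h~r h′~p h′~q h′~r p≢q p≢r q≢r) refl
      with nonhub B (≢-sym p≢q) (∉-hubs B h~q h′~q) | nonhub B (≢-sym p≢r) (∉-hubs B h~r h′~r)
    ... | inj₁ done | _         = done
    ... | inj₂ _    | inj₁ done = done
    ... | inj₂ (q~z , _) | inj₂ (r~z , _) =
      remove h~q (Adj⇒≢ R h~p) (≢-sym p≢q) (λ h≢q → remove-nonhub
        (book (Adj-sym R h′~p) (Adj-sym R q~z) (Adj-sym R r~z) (Adj-sym R h~p)
              h′~q h′~r (Adj-sym R h~h′) q≢r (≢-sym h≢q) (≢-sym (Adj⇒≢ R h~r)))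
        h≢q (pair-∉ (Adj⇒≢ R h~p) (Adj⇒≢ R h~h′)) (pair-∉ (≢-sym p≢q) (≢-sym (Adj⇒≢ R h′~q))))

    -- Now `h` and `z` are the hubs of a book with the same pages, and the edge from the old hub
    -- `h′` to `p` can go.
    z-joins-hub : (B : Book R) → z ∉ hubs B → z ≢ Book.p B → Adj R z (Book.h B) →
                  Adj R (Book.p B) z → Adj R (Book.q B) z → Adj R (Book.r B) z → Removable
    z-joins-hub (book h~h′ h~p h~q h~r h′~p h′~q h′~r p≢q p≢r q≢r) z∉ z≢p z~h p~z q~z r~z =
      remove h′~p (z∉ ∘ there ∘ here ∘ sym) (≢-sym z≢p) (λ h′≢p → remove-nonhub
        (book (Adj-sym R z~h) h~p h~q h~r (Adj-sym R p~z) (Adj-sym R q~z) (Adj-sym R r~z) p≢q p≢r q≢r)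
        h′≢p (pair-∉ (≢-sym (Adj⇒≢ R h~h′)) (z∉ ∘ there ∘ here ∘ sym)) (pair-∉ (≢-sym (Adj⇒≢ R h~p)) (≢-sym z≢p)))

  -- If `z` is not a page, `nonhub` applies to each page; when it yields no edge, `z` is joined to
  -- all pages and is not a hub. It remains to ask whether `z` is joined to a hub.
  removable-edge : Book R → Removable
  removable-edge B@(book {h} {h′} {p} {q} {r} h~h′ h~p h~q h~r h′~p h′~q h′~r p≢q p≢r q≢r)
    with z ≟ p | z ≟ q | z ≟ r
  ... | yes z≡p | _       | _       = z-is-page B z≡p
  ... | no _    | yes z≡q | _       = z-is-page (rotate B) z≡q
  ... | no _    | no _    | yes z≡r = z-is-page (rotate (rotate B)) z≡r
  ... | no z≢p  | no z≢q  | no z≢r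
    with nonhub B (≢-sym z≢p) (∉-hubs B h~p h′~p) | nonhub B (≢-sym z≢q) (∉-hubs B h~q h′~q)
       | nonhub B (≢-sym z≢r) (∉-hubs B h~r h′~r)
  ... | inj₁ done | _         | _         = done
  ... | inj₂ _    | inj₁ done | _         = done
  ... | inj₂ _    | inj₂ _    | inj₁ done = done
  ... | inj₂ (p~z , z∉ , dp) | inj₂ (q~z , _ , dq) | inj₂ (r~z , _ , dr)
    with Adj? R z h | Adj? R z h′
  ... | inj₁ z~h | _         = z-joins-hub B z∉ z≢p z~h p~z q~z r~z
  ... | inj₂ _   | inj₁ z~h′ = z-joins-hub (swap-hubs B) z∉′ z≢p z~h′ p~z q~z r~z
    where
    z∉′ : z ∉ h′ ∷ h ∷ []
    z∉′ = pair-∉ (z∉ ∘ there ∘ here) (z∉ ∘ here)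
  ... | inj₂ z≁h | inj₂ z≁h′ = sparse B z≁h z≁h′ dp dq dr

-- Putting a vertex of degree 3 back

insert : Fin n → (Fin n → Bool) → (Fin n → Bool)
insert a N j = does (a ≟ j) ∨ N j

𝟙-insert : (N : Fin n → Bool) {a : Fin n} → N a ≡ false → ∀ j → 𝟙 (insert a N j) ≡ δ a j + 𝟙 (N j)
𝟙-insert N {a} Na j with a ≟ j
... | yes refl = cong (suc ∘ 𝟙) (sym Na)
... | no _     = refl

count-insert : (N : Fin n → Bool) {a : Fin n} → N a ≡ false → count (insert a N) ≡ suc (count N)
count-insert N {a} Na = trans (sum-cong-≗ (𝟙-insert N Na))
  (trans (∑-distrib-+ (δ a) (𝟙 ∘ N)) (cong (_+ count N) (∑-δ a)))

insert-≢ : (N : Fin n → Bool) {a b : Fin n} → a ≢ b → N b ≡ false → insert a N b ≡ false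
insert-≢ N {a} {b} a≢b Nb = cong₂ _∨_ (dec-false (a ≟ b) a≢b) Nb

-- A single term above `c` would push the sum above `n * c`.
∑-tight : (f : Fin n → ℕ) (c : ℕ) → (∀ j → c ≤ f j) → ∑ f ≤ n * c → ∀ j → f j ≡ c
∑-tight {n} f c c≤f ∑≤ j = ≤-antisym (≮⇒≥ c≮f) (c≤f j)
  where
  c≮f : ¬ c < f j
  c≮f c<f = <⇒≱ (begin-strict
    n * c                    <⟨ n<1+n _ ⟩
    suc (n * c)              ≡⟨ +-comm 1 _ ⟩
    n * c + 1                ≡⟨ cong (_+ 1) (sym (∑-const n c)) ⟩
    ∑ {n} (const c) + 1      ≡⟨ sym (∑-+δ (const c) j) ⟩
    ∑ (λ i → c + δ j i)      ≤⟨ ∑-mono pointwise ⟩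
    ∑ f                      ∎) ∑≤
    where
    open ≤-Reasoning
    pointwise : ∀ i → c + δ j i ≤ f i
    pointwise i with j ≟ i
    ... | yes refl = subst (_≤ f j) (+-comm 1 c) c<f
    ... | no _     = subst (_≤ f i) (sym (+-identityʳ c)) (c≤f i)

potentially-self : {G : Graph n} → Book G → Potentially G
potentially-self {G = G} B = G , (λ _ → refl) , B

-- The new graph has the degrees of `G ∖ v` at each vertex, so `v` can keep its neighbours.
potentially-∖ : (G : Graph (suc n)) (v : Fin (suc n)) → Potentially (G ∖ v) → Potentially G
potentially-∖ G v (H , H≡ , B) = potentially-extend G v H (nbr G v) (sym (deg-self G v))
  (λ j → trans (cong (𝟙 (nbr G v j) +_) (H≡ j)) (sym (deg-punchIn G v j))) B

-- On 4 vertices all degrees are at most 3, so the degree sum is at most 12, short of 14.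
large⇒5≤n : (G : Graph n) → 4 ≤ n → 4 * n ≤ degSum G + 2 → 5 ≤ n
large⇒5≤n {n} G 4≤n large with m≤n⇒m<n∨m≡n 4≤n
... | inj₁ 4<n = 4<n
... | inj₂ 4≡n = contradiction 4≤n (<⇒≱ (s≤s (≤-trans n≤2 (n≤1+n 2))))
  where
  open ≤-Reasoning
  n≤2 : n ≤ 2
  n≤2 = +-cancelʳ-≤ (n * 3) n 2 (begin
    n + n * 3                  ≡⟨ lemma n ⟩
    4 * n                      ≤⟨ large ⟩
    degSum G + 2               ≤⟨ +-mono-≤ (∑-mono (λ v → ≤-pred (subst (deg G v <_) (sym 4≡n) (deg<n G v)))) ≤-refl ⟩
    ∑ {n} (const 3) + 2        ≡⟨ cong (_+ 2) (∑-const n 3) ⟩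
    n * 3 + 2                  ≡⟨ +-comm (n * 3) 2 ⟩
    2 + n * 3                  ∎)
    where
    lemma : ∀ n → n + n * 3 ≡ 4 * n
    lemma = solve-∀

module _ (4≤n : 4 ≤ n) (G : Graph (suc n)) (v : Fin (suc n)) (deg≡3 : deg G v ≡ 3) (3≤deg : ∀ w → 3 ≤ deg G w)
  (large : 4 * (suc n) ≤ degSum G + 2)
  (ih : (H : Graph n) → 4 * n ≤ degSum H + 2 → degSum H + 4 ≡ degSum G → Potentially H)
  where

  private
    Q : Graph n
    Q = G ∖ v

    N : Fin n → Bool
    N = nbr G v

    module _ (R : Graph n) (z : Fin n)
      (deg-R : ∀ j → deg R j + δ z j ≡ deg Q j + 𝟙 (N j)) where

      -- Away from `z` the graph `R` already has the degrees of `G`; at `z` it lacks one, which the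
      -- edge from `v` will supply.
      deg-R′ : ∀ j → deg R j + δ z j ≡ deg G (punchIn v j)
      deg-R′ j = trans (deg-R j) (trans (+-comm (deg Q j) _) (sym (deg-punchIn G v j)))

      -- Deleting `v` costs 6 and raising two degrees gives back 2. The bound 4n - 2 drops by the
      -- same 4, whence `large-R`.
      degSum-R : degSum R + 4 ≡ degSum G
      degSum-R = begin
        degSum R + 4                                ≡⟨ sym (+-assoc (degSum R) 1 3) ⟩
        degSum R + 1 + 3                            ≡⟨ cong (_+ 3) (sym (∑-+δ (deg R) z)) ⟩
        ∑ (λ j → deg R j + δ z j) + 3               ≡⟨ cong (_+ 3) (sum-cong-≗ deg-R) ⟩
        ∑ (λ j → deg Q j + 𝟙 (N j)) + 3             ≡⟨ cong (_+ 3) (∑-distrib-+ (deg Q) (𝟙 ∘ N)) ⟩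
        degSum Q + count N + 3                      ≡⟨ cong (λ d → degSum Q + d + 3) (trans (sym (deg-self G v)) deg≡3) ⟩
        degSum Q + 3 + 3                            ≡⟨ +-assoc (degSum Q) 3 3 ⟩
        degSum Q + (3 + 3)                          ≡⟨ cong (λ d → degSum Q + (d + d)) (sym deg≡3) ⟩
        degSum Q + (deg G v + deg G v)              ≡⟨ sym (degSum-∖ G v) ⟩
        degSum G                                    ∎
        where open ≡-Reasoning

      large-R : 4 * n ≤ degSum R + 2
      large-R = +-cancelʳ-≤ 4 _ _ (begin
        4 * n + 4        ≡⟨ lemma₁ n ⟩
        4 * (suc n)            ≤⟨ large ⟩
        degSum G + 2           ≡⟨ cong (_+ 2) (sym degSum-R) ⟩
        degSum R + 4 + 2       ≡⟨ lemma₂ (degSum R) ⟩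
        degSum R + 2 + 4       ∎)
        where
        open ≤-Reasoning
        lemma₁ : ∀ n → 4 * n + 4 ≡ 4 * (suc n)
        lemma₁ = solve-∀
        lemma₂ : ∀ s → s + 4 + 2 ≡ s + 2 + 4
        lemma₂ = solve-∀

      -- v is put back by subdividing an edge ab and joining it to z.
      lift : Potentially R → Potentially G
      lift (R′ , R′≡ , B) with removable-edge R′ z (large⇒5≤n R 4≤n large-R)
             (λ {t} t≢z → subst (3 ≤_)
               (trans (sym (deg-R′ t)) (trans (cong (deg R t +_) (δ-≢ (≢-sym t≢z))) (trans (+-identityʳ _) (sym (R′≡ t)))))
               (3≤deg (punchIn v t)))
             (subst (λ s → 4 * n ≤ s + 2) (sym (sum-cong-≗ R′≡)) large-R) B
      ... | a , b , a≢b , a~b , a≢z , b≢z , B′ = potentially-extend G v (setEdge R′ a≢b false) N₃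
        (trans (count-insert N₂ z∉N₂) (trans (cong suc (trans (count-insert N₁ a∉N₁) (cong suc (count-insert ∅ {b} refl))))
          (trans (cong (3 +_) (trans (∑-const n 0) (*-zeroʳ n))) (sym deg≡3))))
        (λ j → begin
          𝟙 (N₃ j) + d j
            ≡⟨ cong (_+ d j) (trans (𝟙-insert N₂ z∉N₂ j) (cong (δ z j +_) (trans (𝟙-insert N₁ a∉N₁ j) (cong (δ a j +_) (𝟙-insert ∅ {b} refl j))))) ⟩
          δ z j + (δ a j + (δ b j + 0)) + d j
            ≡⟨ lemma (δ z j) (δ a j) (δ b j) (d j) ⟩
          d j + (δ a j + δ b j) + δ z j
            ≡⟨ cong (_+ δ z j) (trans (sym (removeEdge-deg R′ a≢b a~b j)) (R′≡ j)) ⟩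
          deg R j + δ z j
            ≡⟨ deg-R′ j ⟩
          deg G (punchIn v j)
            ∎)
        B′
        where
        open ≡-Reasoning
        d = deg (setEdge R′ a≢b false)
        ∅ : Fin n → Bool
        ∅ _ = false
        N₁ = insert b ∅
        N₂ = insert a N₁
        N₃ = insert z N₂
        a∉N₁ : N₁ a ≡ false
        a∉N₁ = insert-≢ ∅ (≢-sym a≢b) refl
        z∉N₂ : N₂ z ≡ false
        z∉N₂ = insert-≢ N₁ a≢z (insert-≢ ∅ b≢z refl)
        lemma : ∀ z a b d → z + (a + (b + 0)) + d ≡ d + (a + b) + z
        lemma = solve-∀

  cubic-vertex : Potentially G
  cubic-vertex = case enumerate {k = 3} N (trans (sym (deg-self G v)) deg≡3) of λ where
    (e , e-inj , e-nbr , e-all) →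
      case augment G v 3≤deg 4≤n e e-inj e-nbr e-all of λ where
        (inj₁ B)             → potentially-self B
        (inj₂ (R , c , R+c)) → lift R (e c) R+c (ih R (large-R R (e c) R+c) (degSum-R R (e c) R+c))

-- The octahedron

-- If G ∖ v is octahedral, move one edge of v so that it no longer is.
module _ (n≡6 : n ≡ 6) (G : Graph (suc n)) (v : Fin (suc n))
  (least : ∀ w → deg G v ≤ deg G w) (0<deg : 0 < deg G v)
  (regular : ∀ j → deg (G ∖ v) j ≡ 4)
  (ih : (H : Graph n) → 24 ≤ degSum H + 2 → Potentially H ⊎ (∀ j → deg H j ≡ 4))
  where

  private
    Q : Graph n
    Q = G ∖ v

    N : Fin n → Bool
    N = nbr G v

    deg-G : ∀ j → deg G (punchIn v j) ≡ 𝟙 (N j) + 4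
    deg-G j = trans (deg-punchIn G v j) (cong (𝟙 (N j) +_) (regular j))

    -- In `Q` each vertex is non-adjacent to two of the six, one of which is the vertex itself.
    non-neighbour : ∀ a → ∃[ a′ ] adj Q a a′ ≡ false × a ≢ a′
    non-neighbour a with fresh (not ∘ adj Q a) (a ∷ []) (≤-reflexive (sym
        (+-cancelˡ-≡ 4 _ 2 (trans (cong (_+ count (not ∘ adj Q a)) (sym (regular a)))
          (trans (count+count-not (adj Q a)) n≡6)))))
    ... | a′ , e , a′∉ = a′ , not-injective e , a′∉ ∘ here ∘ sym

    -- Otherwise `v` is joined to `a` and to the four neighbours of `a′`, so all degrees of `G` are
    -- at least 5 by minimality. As those of `Q` are 4, `v` is joined to all six vertices, yet its
    -- degree is at most that of `a`, which is 5.
    exists-unjoined : ∀ {a a′} → N a ≡ true → adj Q a′ a ≡ false → ∃[ y ] Adj Q a′ y × N y ≡ false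
    exists-unjoined {a} {a′} Na a′≁a with any? (λ y → (adj Q a′ y ≟ᵇ true) ×-dec (N y ≟ᵇ false))
    ... | yes found = found
    ... | no none = contradiction 6≤deg (<⇒≱ (s≤s (≤-trans (least (punchIn v a))
                       (≤-reflexive (trans (deg-G a) (cong (λ b → 𝟙 b + 4) Na))))))
      where
      open ≤-Reasoning
      pointwise : ∀ j → 𝟙 (adj Q a′ j) + δ a j ≤ 𝟙 (N j)
      pointwise j with a ≟ j
      ... | yes refl = ≤-reflexive (trans (cong (λ b → 𝟙 b + 1) a′≁a) (cong 𝟙 (sym Na)))
      ... | no _ with Adj? Q a′ j
      ...   | inj₂ a′≁j = ≤-trans (≤-reflexive (cong (λ b → 𝟙 b + 0) a′≁j)) z≤n
      ...   | inj₁ a′~j = ≤-reflexive (trans (cong (λ b → 𝟙 b + 0) a′~j)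
                            (cong 𝟙 (sym (¬-not (λ Nj → none (j , a′~j , Nj))))))
      5≤deg : 5 ≤ deg G v
      5≤deg = begin
        4 + 1                                ≡⟨ cong (_+ 1) (sym (regular a′)) ⟩
        deg Q a′ + 1                         ≡⟨ sym (∑-+δ (𝟙 ∘ adj Q a′) a) ⟩
        ∑ (λ j → 𝟙 (adj Q a′ j) + δ a j)     ≤⟨ ∑-mono pointwise ⟩
        count N                              ≡⟨ sym (deg-self G v) ⟩
        deg G v                              ∎
      1≤N : ∀ j → 1 ≤ 𝟙 (N j)
      1≤N j = +-cancelʳ-≤ 4 1 _ (≤-trans 5≤deg (≤-trans (least (punchIn v j)) (≤-reflexive (deg-G j))))
      6≤deg : 6 ≤ deg G v
      6≤deg = begin
        6                                    ≡⟨ sym n≡6 ⟩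
        n                                    ≡⟨ sym (count-true n) ⟩
        count {n} (const true)               ≤⟨ ∑-mono 1≤N ⟩
        count N                              ≡⟨ sym (deg-self G v) ⟩
        deg G v                              ∎

    module _ {a a′ y : Fin n} (Na : N a ≡ true) (a≁a′ : adj Q a a′ ≡ false) (a≢a′ : a ≢ a′)
      (a′~y : Adj Q a′ y) (Ny : N y ≡ false) where

      y≢a : y ≢ a
      y≢a refl = true≢false Na Ny

      a′≢y : a′ ≢ y
      a′≢y = Adj⇒≢ Q a′~y

      Q₁ Q₂ : Graph n
      Q₁ = setEdge Q a≢a′ true
      Q₂ = setEdge Q₁ a′≢y false

      -- The vertex `a′` gains `a` and loses `y`, so only the degrees of `a` and `y` change.
      deg-Q₂ : ∀ j → deg Q₂ j + δ y j ≡ 4 + δ a j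
      deg-Q₂ j = +-cancelʳ-≡ (δ a′ j) _ _ (begin
        deg Q₂ j + δ y j + δ a′ j            ≡⟨ lemma₁ (deg Q₂ j) (δ y j) (δ a′ j) ⟩
        deg Q₂ j + (δ a′ j + δ y j)          ≡⟨ sym (removeEdge-deg Q₁ a′≢y (trans (setEdge-offʳ Q a≢a′ y≢a (≢-sym a′≢y)) a′~y) j) ⟩
        deg Q₁ j                             ≡⟨ addEdge-deg Q a≢a′ a≁a′ j ⟩
        deg Q j + (δ a j + δ a′ j)           ≡⟨ cong (_+ (δ a j + δ a′ j)) (regular j) ⟩
        4 + (δ a j + δ a′ j)                 ≡⟨ sym (+-assoc 4 (δ a j) (δ a′ j)) ⟩
        4 + δ a j + δ a′ j                   ∎)
        where
        open ≡-Reasoning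
        lemma₁ : ∀ d y a → d + y + a ≡ d + (a + y)
        lemma₁ = solve-∀

      degSum-Q₂ : degSum Q₂ ≡ 24
      degSum-Q₂ = +-cancelʳ-≡ 1 _ _ (begin
        degSum Q₂ + 1                        ≡⟨ sym (∑-+δ (deg Q₂) y) ⟩
        ∑ (λ j → deg Q₂ j + δ y j)           ≡⟨ sum-cong-≗ deg-Q₂ ⟩
        ∑ (λ j → 4 + δ a j)                  ≡⟨ ∑-+δ (const 4) a ⟩
        ∑ {n} (const 4) + 1                  ≡⟨ cong (_+ 1) (∑-const n 4) ⟩
        n * 4 + 1                            ≡⟨ cong (λ k → k * 4 + 1) n≡6 ⟩
        24 + 1                               ∎)
        where open ≡-Reasoning

      𝟙-split-a : ∀ j → 𝟙 (N j) ≡ δ a j + 𝟙 ((N ─ a) j)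
      𝟙-split-a j = trans (𝟙-split N a j) (cong (λ b → 𝟙 (b ∧ does (a ≟ j)) + 𝟙 ((N ─ a) j)) Na)

      y∉N─a : (N ─ a) y ≡ false
      y∉N─a = cong (_∧ not (does (a ≟ y))) Ny

      -- `Q₂` has degree 5 at `a`, so the exception is ruled out and its degrees are realized with a
      -- book. Joining `v` to `y` instead of `a` makes up for the change of degrees.
      move-edge : Potentially G
      move-edge with ih Q₂ (≤-trans (≤-reflexive (sym degSum-Q₂)) (m≤m+n _ 2))
      ... | inj₂ Q₂-regular = contradiction
        (trans (sym (cong₂ _+_ (Q₂-regular a) (δ-≢ y≢a))) (trans (deg-Q₂ a) (cong (4 +_) (δ-refl a)))) λ ()
      ... | inj₁ (H , H≡ , B) = potentially-extend G v H (insert y (N ─ a))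
        (begin
          count (insert y (N ─ a))            ≡⟨ count-insert (N ─ a) y∉N─a ⟩
          suc (count (N ─ a))                 ≡⟨ cong (λ b → 𝟙 b + count (N ─ a)) (sym Na) ⟩
          𝟙 (N a) + count (N ─ a)             ≡⟨ sym (count-split N a) ⟩
          count N                             ≡⟨ sym (deg-self G v) ⟩
          deg G v                             ∎)
        (λ j → begin
          𝟙 (insert y (N ─ a) j) + deg H j         ≡⟨ cong₂ _+_ (𝟙-insert (N ─ a) y∉N─a j) (H≡ j) ⟩
          δ y j + 𝟙 ((N ─ a) j) + deg Q₂ j         ≡⟨ lemma₂ (δ y j) (𝟙 ((N ─ a) j)) (deg Q₂ j) ⟩
          𝟙 ((N ─ a) j) + (deg Q₂ j + δ y j)       ≡⟨ cong (𝟙 ((N ─ a) j) +_) (deg-Q₂ j) ⟩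
          𝟙 ((N ─ a) j) + (4 + δ a j)              ≡⟨ lemma₃ (𝟙 ((N ─ a) j)) (δ a j) ⟩
          δ a j + 𝟙 ((N ─ a) j) + 4                ≡⟨ cong (_+ 4) (sym (𝟙-split-a j)) ⟩
          𝟙 (N j) + 4                              ≡⟨ sym (deg-G j) ⟩
          deg G (punchIn v j)                      ∎)
        B
        where
        open ≡-Reasoning
        lemma₂ : ∀ y n d → y + n + d ≡ n + (d + y)
        lemma₂ = solve-∀
        lemma₃ : ∀ n a → n + (4 + a) ≡ a + n + 4
        lemma₃ = solve-∀

  octahedral-deletion : Potentially G
  octahedral-deletion with count>0⇒∃ N (subst (0 <_) (deg-self G v) 0<deg)
  ... | a , Na with non-neighbour a
  ...   | a′ , a≁a′ , a≢a′ with exists-unjoined Na (trans (adj-sym Q a′ a) a≁a′)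
  ...     | y , a′~y , Ny = move-edge Na a≁a′ a≢a′ a′~y Ny

-- Regular graphs

-- `E` is symmetrized, so that each edge can be listed at just one of its ends.
fromNeighbours : Vec (List (Fin n)) n → Graph n
fromNeighbours {n} L = record
  { adj        = λ u w → not (does (u ≟ w)) ∧ (E u w ∨ E w u)
  ; adj-sym    = λ u w → cong₂ _∧_ (adj-sym (completeMultipartite (λ i → i)) u w) (∨-comm (E u w) (E w u))
  ; adj-irrefl = λ u → cong (λ b → not b ∧ (E u u ∨ E u u)) (dec-true (u ≟ u) refl)
  }
  where
  E : Fin n → Fin n → Bool
  E u w = does (w ∈? lookup L u)

Regular : ℕ → Graph n → Set
Regular d G = ∀ v → deg G v ≡ d

∑-splitAt : ∀ m {n} (f : Fin (m + n) → ℕ) → ∑ f ≡ ∑ (λ i → f (i ↑ˡ n)) + ∑ (λ j → f (m ↑ʳ j))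
∑-splitAt zero    f = refl
∑-splitAt (suc m) f = trans (cong (f zero +_) (∑-splitAt m (f ∘ suc))) (sym (+-assoc (f zero) _ _))

infixr 5 _⊕_
_⊕_ : Graph m → Graph n → Graph (m + n)
_⊕_ {m} {n} G H = record
  { adj        = λ u w → A (splitAt m u) (splitAt m w)
  ; adj-sym    = λ u w → A-sym (splitAt m u) (splitAt m w)
  ; adj-irrefl = λ u → A-irrefl (splitAt m u)
  }
  where
  A : Fin m ⊎ Fin n → Fin m ⊎ Fin n → Bool
  A (inj₁ u) (inj₁ w) = adj G u w
  A (inj₂ u) (inj₂ w) = adj H u w
  A _        _        = false
  A-sym : ∀ x y → A x y ≡ A y x
  A-sym (inj₁ u) (inj₁ w) = adj-sym G u w
  A-sym (inj₁ u) (inj₂ w) = refl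
  A-sym (inj₂ u) (inj₁ w) = refl
  A-sym (inj₂ u) (inj₂ w) = adj-sym H u w
  A-irrefl : ∀ x → A x x ≡ false
  A-irrefl (inj₁ u) = adj-irrefl G u
  A-irrefl (inj₂ u) = adj-irrefl H u

⊕-adjˡ : (G : Graph m) (H : Graph n) {u w : Fin m} → Adj G u w → Adj (G ⊕ H) (u ↑ˡ n) (w ↑ˡ n)
⊕-adjˡ {m} {n} G H {u} {w} u~w rewrite splitAt-↑ˡ m u n | splitAt-↑ˡ m w n = u~w

⊕-regular : ∀ {d} (G : Graph m) (H : Graph n) → Regular d G → Regular d H → Regular d (G ⊕ H)
⊕-regular {m} {n} {d} G H G-reg H-reg v =
  trans (∑-splitAt m (𝟙 ∘ adj (G ⊕ H) v)) (split (splitAt m v) refl)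
  where
  open ≡-Reasoning
  split : ∀ x → splitAt m v ≡ x →
          ∑ (λ i → 𝟙 (adj (G ⊕ H) v (i ↑ˡ n))) + ∑ (λ j → 𝟙 (adj (G ⊕ H) v (m ↑ʳ j))) ≡ d
  split (inj₁ u) e = begin
    ∑ (λ i → 𝟙 (adj (G ⊕ H) v (i ↑ˡ n))) + ∑ (λ j → 𝟙 (adj (G ⊕ H) v (m ↑ʳ j)))
      ≡⟨ cong₂ _+_ (sum-cong-≗ left) (sum-cong-≗ right) ⟩
    deg G u + ∑ {n} (const 0)
      ≡⟨ cong₂ _+_ (G-reg u) (trans (∑-const n 0) (*-zeroʳ n)) ⟩
    d + 0
      ≡⟨ +-identityʳ d ⟩
    d ∎
    where
    left : ∀ i → 𝟙 (adj (G ⊕ H) v (i ↑ˡ n)) ≡ 𝟙 (adj G u i)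
    left i rewrite e | splitAt-↑ˡ m i n = refl
    right : ∀ j → 𝟙 (adj (G ⊕ H) v (m ↑ʳ j)) ≡ 0
    right j rewrite e | splitAt-↑ʳ m n j = refl
  split (inj₂ u) e = begin
    ∑ (λ i → 𝟙 (adj (G ⊕ H) v (i ↑ˡ n))) + ∑ (λ j → 𝟙 (adj (G ⊕ H) v (m ↑ʳ j)))
      ≡⟨ cong₂ _+_ (sum-cong-≗ left) (sum-cong-≗ right) ⟩
    ∑ {m} (const 0) + deg H u
      ≡⟨ cong₂ _+_ (trans (∑-const m 0) (*-zeroʳ m)) (H-reg u) ⟩
    d ∎
    where
    left : ∀ i → 𝟙 (adj (G ⊕ H) v (i ↑ˡ n)) ≡ 0
    left i rewrite e | splitAt-↑ˡ m i n = refl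
    right : ∀ j → 𝟙 (adj (G ⊕ H) v (m ↑ʳ j)) ≡ 𝟙 (adj H u j)
    right j rewrite e | splitAt-↑ʳ m n j = refl

complete : ∀ n → Graph n
complete n = completeMultipartite (λ i → i)

octahedron : Graph 6
octahedron = completeMultipartite {k = 3} (lookup (0F ∷ 0F ∷ 1F ∷ 1F ∷ 2F ∷ 2F ∷ []))

octahedron-regular : Regular 4 octahedron
octahedron-regular = from-yes (all? λ v → deg octahedron v ≟ⁿ 4)

K₅-regular : Regular 4 (complete 5)
K₅-regular = from-yes (all? λ v → deg (complete 5) v ≟ⁿ 4)

K₅-book : Book (complete 5)
K₅-book = book {h = 0F} {1F} {2F} {3F} {4F} refl refl refl refl refl refl refl (λ ()) (λ ()) (λ ())

-- One base case per residue modulo 5; after that a disjoint `complete 5` is added, which supplies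
-- the book even when the rest is the octahedron. By `quartic-bookless`, 6 vertices are a true
-- exception.
quartic : ∀ k → ∃[ G ] Regular {5 + k} 4 G × (k ≢ 1 → Book G)
quartic 0 = complete 5 , K₅-regular , λ _ → K₅-book
quartic 1 = octahedron , octahedron-regular , contradiction refl
quartic 2 = G , from-yes (all? λ v → deg G v ≟ⁿ 4) ,
  λ _ → book {h = 0F} {1F} {2F} {3F} {4F} refl refl refl refl refl refl refl (λ ()) (λ ()) (λ ())
  where
  -- Here and in the next two graphs the book has hubs `0F` and `1F`, whose degrees it exhausts; the
  -- remaining lists fill up the other degrees.
  G = fromNeighbours
    ((1F ∷ 2F ∷ 3F ∷ 4F ∷ []) ∷ (2F ∷ 3F ∷ 4F ∷ []) ∷ (5F ∷ 6F ∷ []) ∷ (5F ∷ 6F ∷ []) ∷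
     (5F ∷ 6F ∷ []) ∷ (6F ∷ []) ∷ [] ∷ [])
quartic 3 = G , from-yes (all? λ v → deg G v ≟ⁿ 4) ,
  λ _ → book {h = 0F} {1F} {2F} {3F} {4F} refl refl refl refl refl refl refl (λ ()) (λ ()) (λ ())
  where
  G = fromNeighbours
    ((1F ∷ 2F ∷ 3F ∷ 4F ∷ []) ∷ (2F ∷ 3F ∷ 4F ∷ []) ∷ (5F ∷ 6F ∷ []) ∷ (6F ∷ 7F ∷ []) ∷
     (5F ∷ 7F ∷ []) ∷ (6F ∷ 7F ∷ []) ∷ (7F ∷ []) ∷ [] ∷ [])
quartic 4 = G , from-yes (all? λ v → deg G v ≟ⁿ 4) ,
  λ _ → book {h = 0F} {1F} {2F} {3F} {4F} refl refl refl refl refl refl refl (λ ()) (λ ()) (λ ())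
  where
  G = fromNeighbours
    ((1F ∷ 2F ∷ 3F ∷ 4F ∷ []) ∷ (2F ∷ 3F ∷ 4F ∷ []) ∷ (5F ∷ 6F ∷ []) ∷ (5F ∷ 7F ∷ []) ∷
     (6F ∷ 8F ∷ []) ∷ (7F ∷ 8F ∷ []) ∷ (7F ∷ 8F ∷ []) ∷ (8F ∷ []) ∷ [] ∷ [])
quartic (suc (suc (suc (suc (suc k))))) = case quartic k of λ where
  (G , G-regular , _) → complete 5 ⊕ G , ⊕-regular (complete 5) G K₅-regular G-regular ,
    λ _ → mapBook (_↑ˡ (5 + k)) (↑ˡ-injective (5 + k) _ _) (λ {u} {w} → ⊕-adjˡ (complete 5) G {u} {w}) K₅-book

K₃-regular : Regular 2 (complete 3)
K₃-regular = from-yes (all? λ v → deg (complete 3) v ≟ⁿ 2)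

-- Cycles of lengths 3, 4 and 5, one per residue modulo 3, and then disjoint triangles.
twoRegular : ∀ k → ∃[ G ] Regular {3 + k} 2 G
twoRegular 0 = complete 3 , K₃-regular
twoRegular 1 = G , from-yes (all? λ v → deg G v ≟ⁿ 2)
  where G = fromNeighbours ((1F ∷ []) ∷ (2F ∷ []) ∷ (3F ∷ []) ∷ (0F ∷ []) ∷ [])
twoRegular 2 = G , from-yes (all? λ v → deg G v ≟ⁿ 2)
  where G = fromNeighbours ((1F ∷ []) ∷ (2F ∷ []) ∷ (3F ∷ []) ∷ (4F ∷ []) ∷ (0F ∷ []) ∷ [])
twoRegular (suc (suc (suc k))) = case twoRegular k of λ where
  (G , G-regular) → complete 3 ⊕ G , ⊕-regular (complete 3) G K₃-regular G-regular

-- The induction on the number of vertices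

least-degree : (G : Graph (suc n)) → ∃[ v ] ∀ w → deg G v ≤ deg G w
least-degree {n} G = argmin (deg G) zero (allFin (suc n)) ,
  λ w → All.lookup (f[argmin]≤f[xs] {f = deg G} zero (allFin (suc n))) (∈-allFin w)

BookOrQuartic : Graph n → Set
BookOrQuartic {n} G = Potentially G ⊎ (n ≡ 6 × Regular 4 G)

degSum-regular : ∀ {d} (G : Graph n) → Regular d G → degSum G ≡ n * d
degSum-regular {n} {d} G G-regular = trans (sum-cong-≗ G-regular) (∑-const n d)

4-regular : 4 ≤ n → (G : Graph (suc n)) → Regular 4 G → BookOrQuartic G
4-regular 4≤n G G-regular with m≤n⇒∃[o]m+o≡n 4≤n
... | k , refl with k ≟ⁿ 1
...   | yes refl = inj₂ (refl , G-regular)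
...   | no k≢1   = case quartic k of λ where
  (H , H-regular , B) → inj₁ (H , (λ j → trans (H-regular j) (sym (G-regular j))) , B k≢1)

-- With n = 4 + o and d = 5 + e the difference of the two sides is a polynomial with non-negative
-- coefficients.
large-degree : ∀ {d} → 4 ≤ n → 5 ≤ d → 4 * n + (d + d) ≤ suc n * d + 2
large-degree 4≤n 5≤d with m≤n⇒∃[o]m+o≡n 4≤n | m≤n⇒∃[o]m+o≡n 5≤d
... | o , refl | e , refl = subst (4 * (4 + o) + (5 + e + (5 + e)) ≤_) (sym (lemma o e)) (m≤m+n _ (1 + o + 3 * e + o * e))
  where
  lemma : ∀ o e → suc (4 + o) * (5 + e) + 2 ≡ 4 * (4 + o) + (5 + e + (5 + e)) + (1 + o + 3 * e + o * e)
  lemma = solve-∀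

module _ (4≤n : 4 ≤ n) (ih : (H : Graph n) → 4 * n ≤ degSum H + 2 → BookOrQuartic H)
  (G : Graph (suc n)) (large : 4 * suc n ≤ degSum G + 2) where

  private
    delete : (v : Fin (suc n)) → (∀ w → deg G v ≤ deg G w) →
             4 * n + (deg G v + deg G v) ≤ degSum G + 2 → Potentially G
    delete v least large-v = case ih (G ∖ v) large-∖ of λ where
        (inj₁ P)               → potentially-∖ G v P
        (inj₂ (n≡6 , regular)) → octahedral-deletion n≡6 G v least (0<deg regular) regular
          (λ H large-H → case ih H (subst (λ k → 4 * k ≤ degSum H + 2) (sym n≡6) large-H) of λ where
            (inj₁ P)             → inj₁ P
            (inj₂ (_ , regular)) → inj₂ regular)
      where
      open ≤-Reasoning
      d = deg G v
      large-∖ : 4 * n ≤ degSum (G ∖ v) + 2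
      large-∖ = +-cancelʳ-≤ (d + d) _ _ (begin
        4 * n + (d + d)                    ≤⟨ large-v ⟩
        degSum G + 2                       ≡⟨ cong (_+ 2) (degSum-∖ G v) ⟩
        degSum (G ∖ v) + (d + d) + 2       ≡⟨ lemma (degSum (G ∖ v)) d ⟩
        degSum (G ∖ v) + 2 + (d + d)       ∎)
        where
        lemma : ∀ s d → s + (d + d) + 2 ≡ s + 2 + (d + d)
        lemma = solve-∀
      -- If `v` were isolated, `G` would have degree sum 4n, less than 4(n + 1) - 2.
      0<deg : Regular 4 (G ∖ v) → 0 < d
      0<deg regular = n≢0⇒n>0 λ d≡0 → <⇒≱ (n<1+n 3) (+-cancelʳ-≤ (n * 4) 4 3 (begin
        4 + n * 4                          ≡⟨ lemma n ⟩
        4 * suc n                          ≤⟨ large ⟩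
        degSum G + 2                       ≡⟨ cong (_+ 2) (degSum-∖ G v) ⟩
        degSum (G ∖ v) + (d + d) + 2       ≡⟨ cong₂ (λ s d → s + (d + d) + 2) (degSum-regular (G ∖ v) regular) d≡0 ⟩
        n * 4 + 0 + 2                      ≡⟨ lemma₂ (n * 4) ⟩
        2 + n * 4                          ≤⟨ n≤1+n _ ⟩
        3 + n * 4                          ∎))
        where
        lemma : ∀ n → 4 + n * 4 ≡ 4 * suc n
        lemma = solve-∀
        lemma₂ : ∀ s → s + 0 + 2 ≡ 2 + s
        lemma₂ = solve-∀

    -- Deleting `v` lowers the degree sum by at most 4, which is how much the bound drops.
    low-degree : (v : Fin (suc n)) → deg G v ≤ 2 → ¬ (degSum G + 2 < 4 * n + (deg G v + deg G v))
    low-degree v d≤2 few = <⇒≱ few (≤-trans (+-mono-≤ (≤-refl {4 * n}) (+-mono-≤ d≤2 d≤2))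
      (subst (_≤ degSum G + 2) (lemma n) large))
      where
      lemma : ∀ n → 4 * suc n ≡ 4 * n + (2 + 2)
      lemma = solve-∀

    -- Deleting `v` can leave too few edges only if the least degree is 3 or 4: `low-degree`
    -- excludes smaller values and `large-degree` larger ones.
    keep : (v : Fin (suc n)) → (∀ w → deg G v ≤ deg G w) →
           degSum G + 2 < 4 * n + (deg G v + deg G v) → ∀ d → deg G v ≡ d → BookOrQuartic G
    keep v least few 3 v≡3 =
      inj₁ (cubic-vertex 4≤n G v v≡3 (λ w → subst (_≤ deg G w) v≡3 (least w)) large
        λ H large-H H+4≡G → case ih H large-H of λ where
          (inj₁ P)             → P
          -- A 4-regular `H` would give `G` degree sum 4n + 4, whereas `few` at degree 3 says that
          -- it is below 4n + 4.
          (inj₂ (_ , regular)) → contradiction (≤-reflexive (begin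
            4 * n + 6                ≡⟨ lemma n ⟩
            n * 4 + 4 + 2            ≡⟨ cong (λ s → s + 4 + 2) (sym (degSum-regular H regular)) ⟩
            degSum H + 4 + 2         ≡⟨ cong (_+ 2) H+4≡G ⟩
            degSum G + 2             ∎)) (<⇒≱ (subst (λ d → degSum G + 2 < 4 * n + (d + d)) v≡3 few)))
      where
      open ≡-Reasoning
      lemma : ∀ n → 4 * n + 6 ≡ n * 4 + 4 + 2
      lemma = solve-∀
    -- All degrees are at least 4, and `few` bounds their sum by 4n + 5, hence by 4(n + 1) since it
    -- is even. So every degree is exactly 4.
    keep v least few 4 v≡4 = 4-regular 4≤n G
      (∑-tight (deg G) 4 (λ w → subst (_≤ deg G w) v≡4 (least w)) (at-most (degSum-even G)))
      where
      open ≤-Reasoning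
      at-most : ∃[ h ] degSum G ≡ h + h → degSum G ≤ suc n * 4
      at-most (h , e) = begin
        degSum G                          ≡⟨ e ⟩
        h + h                             ≤⟨ +-mono-≤ h≤ h≤ ⟩
        (2 * n + 2) + (2 * n + 2)         ≡⟨ lemma₂ n ⟩
        suc n * 4                         ∎
        where
        lemma₁ : ∀ n → 4 * n + (4 + 4) ≡ (2 * n + 3) + (2 * n + 3) + 2
        lemma₁ = solve-∀
        lemma₂ : ∀ n → (2 * n + 2) + (2 * n + 2) ≡ suc n * 4
        lemma₂ = solve-∀
        h≤ : h ≤ 2 * n + 2
        h≤ = ≮⇒≥ λ h> → <⇒≱ (subst (λ d → degSum G + 2 < 4 * n + (d + d)) v≡4 few) (begin
          4 * n + (4 + 4)                       ≡⟨ lemma₁ n ⟩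
          (2 * n + 3) + (2 * n + 3) + 2         ≤⟨ +-mono-≤ (+-mono-≤ (3≤ h>) (3≤ h>)) ≤-refl ⟩
          h + h + 2                             ≡⟨ cong (_+ 2) (sym e) ⟩
          degSum G + 2                          ∎)
          where
          3≤ : 2 * n + 2 < h → 2 * n + 3 ≤ h
          3≤ = subst (_≤ h) (sym (+-suc (2 * n) 2))
    keep v least few (suc (suc (suc (suc (suc e))))) v≡d = contradiction (begin
        4 * n + (d + d)                   ≤⟨ large-degree 4≤n (subst (5 ≤_) (sym v≡d) (m≤m+n 5 e)) ⟩
        suc n * d + 2                     ≡⟨ cong (_+ 2) (sym (∑-const (suc n) d)) ⟩
        ∑ {suc n} (const d) + 2           ≤⟨ +-mono-≤ (∑-mono least) ≤-refl ⟩
        degSum G + 2                      ∎) (<⇒≱ few)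
      where
      open ≤-Reasoning
      d = deg G v
    keep v least few 0 v≡0 = contradiction few (low-degree v (subst (_≤ 2) (sym v≡0) z≤n))
    keep v least few 1 v≡1 = contradiction few (low-degree v (subst (_≤ 2) (sym v≡1) (s≤s z≤n)))
    keep v least few 2 v≡2 = contradiction few (low-degree v (≤-reflexive v≡2))

  induction-step : BookOrQuartic G
  induction-step = case least-degree G of λ where
    (v , least) → case 4 * n + (deg G v + deg G v) ≤? degSum G + 2 of λ where
      (yes many) → inj₁ (delete v least many)
      (no few)   → keep v least (≰⇒> few) (deg G v) refl

-- Induction on n - 4; the base is vacuous by `large⇒5≤n`.
book-or-quartic : ∀ o → n ≡ 4 + o → (G : Graph n) → 4 * n ≤ degSum G + 2 → BookOrQuartic G
book-or-quartic zero n≡4 G large =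
  contradiction (large⇒5≤n G (≤-reflexive (sym n≡4)) large) (<⇒≱ (≤-reflexive (cong suc n≡4)))
book-or-quartic {suc n} (suc o) n≡ G large = induction-step
  (subst (4 ≤_) (sym (suc-injective n≡)) (m≤m+n 4 o)) (book-or-quartic o (suc-injective n≡)) G large

-- Degree sequences

sum≡∑ : (S : Vec ℕ n) → sum S ≡ ∑ (lookup S)
sum≡∑ []      = refl
sum≡∑ (d ∷ S) = cong (d +_) (sum≡∑ S)

realizes⇒deg : (G : Graph n) (S : Vec ℕ n) → Realizes G S → ∀ j → deg G j ≡ lookup S j
realizes⇒deg G S G-S j = trans (sym (degree≡deg G j)) (G-S j)

realizes⇒degSum : (G : Graph n) (S : Vec ℕ n) → Realizes G S → degSum G ≡ sum S
realizes⇒degSum G S G-S = trans (sum-cong-≗ (realizes⇒deg G S G-S)) (sym (sum≡∑ S))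

book⇒contains : {G : Graph n} → Book G → Contains G K₃,₁,₁
book⇒contains {n} {G} (book {h} {h′} {p} {q} {r} h~h′ h~p h~q h~r h′~p h′~q h′~r p≢q p≢r q≢r) =
  lookup image , (λ {i} {j} → lookup-injective unique i j) , edges
  where
  image : Vec (Fin n) 5
  -- `K₃,₁,₁` lists its part of size three first, so the pages precede the hubs.
  image = p ∷ q ∷ r ∷ h ∷ h′ ∷ []
  unique : Unique image
  unique = (p≢q ∷ p≢r ∷ ≢-sym (Adj⇒≢ G h~p) ∷ ≢-sym (Adj⇒≢ G h′~p) ∷ [])
         ∷ (q≢r ∷ ≢-sym (Adj⇒≢ G h~q) ∷ ≢-sym (Adj⇒≢ G h′~q) ∷ [])
         ∷ (≢-sym (Adj⇒≢ G h~r) ∷ ≢-sym (Adj⇒≢ G h′~r) ∷ [])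
         ∷ (Adj⇒≢ G h~h′ ∷ [])
         ∷ []
         ∷ []
  edges : ∀ u w → Adj K₃,₁,₁ u w → Adj G (lookup image u) (lookup image w)
  edges 0F 3F _ = Adj-sym G h~p
  edges 0F 4F _ = Adj-sym G h′~p
  edges 1F 3F _ = Adj-sym G h~q
  edges 1F 4F _ = Adj-sym G h′~q
  edges 2F 3F _ = Adj-sym G h~r
  edges 2F 4F _ = Adj-sym G h′~r
  edges 3F 0F _ = h~p
  edges 3F 1F _ = h~q
  edges 3F 2F _ = h~r
  edges 3F 4F _ = h~h′
  edges 4F 0F _ = h′~p
  edges 4F 1F _ = h′~q
  edges 4F 2F _ = h′~r
  edges 4F 3F _ = Adj-sym G h~h′
  edges 0F 0F ()
  edges 0F 1F ()
  edges 0F 2F ()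
  edges 1F 0F ()
  edges 1F 1F ()
  edges 1F 2F ()
  edges 2F 0F ()
  edges 2F 1F ()
  edges 2F 2F ()
  edges 3F 3F ()
  edges 4F 4F ()

contains⇒book : {G : Graph n} → Contains G K₃,₁,₁ → Book G
contains⇒book (f , f-inj , hom) = book {h = f 3F} {f 4F} {f 0F} {f 1F} {f 2F}
  (hom 3F 4F refl) (hom 3F 0F refl) (hom 3F 1F refl) (hom 3F 2F refl)
  (hom 4F 0F refl) (hom 4F 1F refl) (hom 4F 2F refl)
  (f-≢ λ ()) (f-≢ λ ()) (f-≢ λ ())
  where
  f-≢ : ∀ {i j} → i ≢ j → f i ≢ f j
  f-≢ i≢j = i≢j ∘ f-inj

potentially⇒potentiallyGraphical : (S : Vec ℕ n) (G : Graph n) → Realizes G S →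
                                   Potentially G → PotentiallyGraphical K₃,₁,₁ S
potentially⇒potentiallyGraphical S G G-S (H , H≡ , B) =
  H , (λ j → trans (degree≡deg H j) (trans (H≡ j) (realizes⇒deg G S G-S j))) , book⇒contains B

graphical⇒potentially : (S : Vec ℕ n) → 4 ≤ n → Graphical S → 4 * n ≤ sum S + 2 →
                        PotentiallyGraphical K₃,₁,₁ S ⊎ (n ≡ 6 × ∀ j → lookup S j ≡ 4)
graphical⇒potentially {n} S 4≤n (G , G-S) large = case m≤n⇒∃[o]m+o≡n 4≤n of λ where
  (o , 4+o≡n) → case book-or-quartic o (sym 4+o≡n) G
      (subst (λ s → 4 * n ≤ s + 2) (sym (realizes⇒degSum G S G-S)) large) of λ where
    (inj₁ P)             → inj₁ (potentially⇒potentiallyGraphical S G G-S P)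
    (inj₂ (n≡6 , G-reg)) → inj₂ (n≡6 , λ j → trans (sym (realizes⇒deg G S G-S j)) (G-reg j))

-- Sequences without a realization containing a book

module _ {G : Graph n} (B : Book G) where
  open Book B

  4≤deg-h : 4 ≤ deg G h
  4≤deg-h = unique⇒length≤count (adj G h) {h′ ∷ p ∷ q ∷ r ∷ []}
    ((Adj⇒≢ G h′~p ∷ Adj⇒≢ G h′~q ∷ Adj⇒≢ G h′~r ∷ []) ∷ (p≢q ∷ p≢r ∷ []) ∷ (q≢r ∷ []) ∷ [] ∷ [])
    (h~h′ ∷ h~p ∷ h~q ∷ h~r ∷ [])

  -- The other hub and the three pages already use up the degree of `h`.
  h-neighbours : deg G h ≤ 4 → ∀ {w} → w ∉ vertices B → adj G h w ≡ false
  h-neighbours d≤4 {w} w∉ = ¬-not λ h~w → <⇒≱ (s≤s d≤4)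
    (unique⇒length≤count (adj G h) {w ∷ h′ ∷ p ∷ q ∷ r ∷ []}
      ((w∉ ∘ there ∘ here ∷ w∉ ∘ there ∘ there ∘ here ∷ w∉ ∘ there ∘ there ∘ there ∘ here
          ∷ w∉ ∘ there ∘ there ∘ there ∘ there ∘ here ∷ [])
        ∷ (Adj⇒≢ G h′~p ∷ Adj⇒≢ G h′~q ∷ Adj⇒≢ G h′~r ∷ []) ∷ (p≢q ∷ p≢r ∷ []) ∷ (q≢r ∷ []) ∷ [] ∷ [])
      (h~w ∷ h~h′ ∷ h~p ∷ h~q ∷ h~r ∷ []))

-- A vertex outside the book is joined to neither hub, so its degree is at most 3.
quartic-bookless : n ≡ 6 → (G : Graph n) → Regular 4 G → ¬ Book G
quartic-bookless {n} n≡6 G G-regular B = case fresh-vertex (vertices B) (≤-reflexive (sym n≡6)) of λ where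
    (w , w∉) → <⇒≱ (n<1+n 6) (begin
      4 + 3                                  ≡⟨ cong (_+ 3) (sym (G-regular w)) ⟩
      deg G w + 3                            ≤⟨ +-mono-≤ (≤-refl {deg G w}) (non-neighbours w w∉) ⟩
      deg G w + count (not ∘ adj G w)        ≡⟨ count+count-not (adj G w) ⟩
      n                                      ≡⟨ n≡6 ⟩
      6                                      ∎)
  where
  open ≤-Reasoning
  open Book B
  non-neighbours : ∀ w → w ∉ vertices B → 3 ≤ count (not ∘ adj G w)
  non-neighbours w w∉ = unique⇒length≤count (not ∘ adj G w) {w ∷ h ∷ h′ ∷ []}
    ((w∉ ∘ here ∷ w∉ ∘ there ∘ here ∷ []) ∷ (Adj⇒≢ G h~h′ ∷ []) ∷ [] ∷ [])
    (cong not (adj-irrefl G w)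
      ∷ cong not (trans (adj-sym G w h) (h-neighbours B (≤-reflexive (G-regular h)) w∉))
      ∷ cong not (trans (adj-sym G w h′) (h-neighbours (swap-hubs B) (≤-reflexive (G-regular h′)) w∉′))
      ∷ [])
    where
    w∉′ : w ∉ vertices (swap-hubs B)
    w∉′ (here e)          = w∉ (there (here e))
    w∉′ (there (here e))  = w∉ (here e)
    w∉′ (there (there e)) = w∉ (there (there e))

fours : Vec ℕ 6
fours = 4 ∷ 4 ∷ 4 ∷ 4 ∷ 4 ∷ 4 ∷ []

fours≡ : ∀ j → lookup fours j ≡ 4
fours≡ = from-yes (all? λ j → lookup fours j ≟ⁿ 4)

lookup≡4⇒fours : (S : Vec ℕ 6) → (∀ j → lookup S j ≡ 4) → S ≡ fours
lookup≡4⇒fours S S≡4 = trans (sym (tabulate∘lookup S)) (tabulate-cong S≡4)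

fours-graphical : Graphical fours
fours-graphical = octahedron , λ j →
  trans (degree≡deg octahedron j) (trans (octahedron-regular j) (sym (fours≡ j)))

fours-bookless : ¬ PotentiallyGraphical K₃,₁,₁ fours
fours-bookless (G , G-fours , contains) = quartic-bookless refl G
  (λ j → trans (realizes⇒deg G fours G-fours j) (fours≡ j)) (contains⇒book {G = G} contains)

-- Only the apex of a cone over a 2-regular graph has degree at least 4.
cone : ∀ k → Graph (4 + k)
cone k = extend (proj₁ (twoRegular k)) zero (const true)

cone-deg : ∀ k j → deg (cone k) (suc j) ≡ 3
cone-deg k j = trans (extend-deg (proj₁ (twoRegular k)) zero (const true) j)
  (cong suc (proj₂ (twoRegular k) j))

cone-deg-apex : ∀ k → deg (cone k) zero ≡ 3 + k
cone-deg-apex k = trans (extend-deg-self (proj₁ (twoRegular k)) zero (const true)) (count-true (3 + k))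

cone-degSum : ∀ k → degSum (cone k) ≡ 12 + 4 * k
cone-degSum k = begin
  degSum (cone k)                       ≡⟨ cong₂ _+_ (cone-deg-apex k) (sum-cong-≗ (cone-deg k)) ⟩
  3 + k + ∑ {3 + k} (const 3)           ≡⟨ cong (3 + k +_) (∑-const (3 + k) 3) ⟩
  3 + k + (3 + k) * 3                   ≡⟨ lemma k ⟩
  12 + 4 * k                            ∎
  where
  open ≡-Reasoning
  lemma : ∀ k → 3 + k + (3 + k) * 3 ≡ 12 + 4 * k
  lemma = solve-∀

coneSeq : ∀ k → Vec ℕ (4 + k)
coneSeq k = tabulate (degree (cone k))

cone-realizes : ∀ k → Realizes (cone k) (coneSeq k)
cone-realizes k j = sym (lookup∘tabulate (degree (cone k)) j)

-- In any realization both hubs would have degree at least 4, so both would be the apex.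
coneSeq-bookless : ∀ k → ¬ PotentiallyGraphical K₃,₁,₁ (coneSeq k)
coneSeq-bookless k (G , G-cone , contains) = apex (Book.h B) (Book.h′ B) (4≤deg-h B) (4≤deg-h (swap-hubs B)) (Adj⇒≢ G (Book.h~h′ B))
  where
  B : Book G
  B = contains⇒book {G = G} contains
  deg-G : ∀ j → deg G j ≡ deg (cone k) j
  deg-G j = trans (realizes⇒deg G (coneSeq k) G-cone j) (sym (realizes⇒deg (cone k) (coneSeq k) (cone-realizes k) j))
  low : ∀ j → ¬ 4 ≤ deg G (suc j)
  low j = <⇒≱ (≤-reflexive (cong suc (trans (deg-G (suc j)) (cone-deg k j))))
  apex : ∀ u w → 4 ≤ deg G u → 4 ≤ deg G w → u ≢ w → ⊥
  apex zero    zero    _  _  u≢w = u≢w refl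
  apex zero    (suc w) _  4≤ _   = low w 4≤
  apex (suc u) w       4≤ _  _   = low u 4≤

-- The values of σ

σ-lower-bound : ∀ k l → 2 ∣ l → SumForces K₃,₁,₁ (4 + k) l → 14 + 4 * k ≤ l
σ-lower-bound k _ (divides q refl) forces = ≮⇒≥ λ l<14+4k →
  coneSeq-bookless k (forces (coneSeq k) (cone k , cone-realizes k) (begin
    -- An even number below 14 + 4k is at most 12 + 4k, the sum of `coneSeq k`, so `l` would force a
    -- book there.
    q * 2                ≤⟨ *-monoˡ-≤ 2 (≤-pred (*-cancelʳ-< 2 q (7 + 2 * k) (subst (q * 2 <_) (lemma₁ k) l<14+4k))) ⟩
    (6 + 2 * k) * 2      ≡⟨ lemma₂ k ⟩
    12 + 4 * k           ≡⟨ sym (cone-degSum k) ⟩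
    degSum (cone k)      ≡⟨ realizes⇒degSum (cone k) (coneSeq k) (cone-realizes k) ⟩
    sum (coneSeq k)      ∎))
  where
  open ≤-Reasoning
  lemma₁ : ∀ k → 14 + 4 * k ≡ (7 + 2 * k) * 2
  lemma₁ = solve-∀
  lemma₂ : ∀ k → (6 + 2 * k) * 2 ≡ 12 + 4 * k
  lemma₂ = solve-∀

4[4+k]≡ : ∀ k → 4 * (4 + k) ≡ 14 + 4 * k + 2
4[4+k]≡ = solve-∀

-- With n = 4 + k the value is 4n - 2, and `k ≢ 2` excludes the 6-term exception.
σ-generic : ∀ k → k ≢ 2 → σ⟨ K₃,₁,₁ , 4 + k ⟩= (14 + 4 * k)
σ-generic k k≢2 = record
  { even    = divides (7 + 2 * k) (lemma k)
  ; forces  = λ S S-graphical large → case graphical⇒potentially S (m≤m+n 4 k) S-graphical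
      (≤-trans (≤-reflexive (4[4+k]≡ k)) (+-mono-≤ large ≤-refl)) of λ where
        (inj₁ P)          → P
        (inj₂ (k≡2 , _))  → contradiction (+-cancelˡ-≡ 4 k 2 k≡2) k≢2
  ; minimum = σ-lower-bound k
  }
  where
  lemma : ∀ k → 14 + 4 * k ≡ (7 + 2 * k) * 2
  lemma = solve-∀

6-term : (S : Vec ℕ 6) → Graphical S → 22 ≤ sum S → PotentiallyGraphical K₃,₁,₁ S ⊎ S ≡ fours
6-term S S-graphical large =
  case graphical⇒potentially S (m≤m+n 4 2) S-graphical (+-mono-≤ large (≤-refl {2})) of λ where
    (inj₁ P)         → inj₁ P
    (inj₂ (_ , S≡4)) → inj₂ (lookup≡4⇒fours S S≡4)

-- The only obstruction from 22 on is `fours`, of sum 24: it defeats every even bound up to 24, and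
-- none of 26 or more.
σ-6 : σ⟨ K₃,₁,₁ , 6 ⟩= 26
σ-6 = record
  { even    = divides 13 refl
  ; forces  = λ S S-graphical large → case 6-term S S-graphical (≤-trans (m≤m+n 22 4) large) of λ where
      (inj₁ P)    → P
      (inj₂ refl) → contradiction large (<⇒≱ (n≤1+n 25))
  ; minimum = λ { _ (divides q refl) forces → ≮⇒≥ λ l<26 → fours-bookless (forces fours fours-graphical
      (*-monoˡ-≤ 2 (≤-pred (*-cancelʳ-< 2 q 13 l<26)))) }
  }

theorem2 : (∀ n → n ≡ 5 ⊎ 7 ≤ n → σ⟨ K₃,₁,₁ , n ⟩= (4 * n ∸ 2))
    ×
    (∀ (S : Vec ℕ 6) → Graphical S → 22 ≤ sum S →
    PotentiallyGraphical K₃,₁,₁ S ⊎ S ≡ 4 ∷ 4 ∷ 4 ∷ 4 ∷ 4 ∷ 4 ∷ [])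
    ×
    (¬ PotentiallyGraphical K₃,₁,₁ (4 ∷ 4 ∷ 4 ∷ 4 ∷ 4 ∷ 4 ∷ []))
    ×
    (σ⟨ K₃,₁,₁ , 6 ⟩= 26)
theorem2 = σ-n , 6-term , fours-bookless , σ-6
  where
  σ-4+ : ∀ k → k ≢ 2 → σ⟨ K₃,₁,₁ , 4 + k ⟩= (4 * (4 + k) ∸ 2)
  σ-4+ k k≢2 = subst (σ⟨ K₃,₁,₁ , 4 + k ⟩=_)
    (sym (trans (cong (_∸ 2) (4[4+k]≡ k)) (m+n∸n≡m (14 + 4 * k) 2))) (σ-generic k k≢2)
  σ-n : ∀ n → n ≡ 5 ⊎ 7 ≤ n → σ⟨ K₃,₁,₁ , n ⟩= (4 * n ∸ 2)
  -- 5 = 4 + 1 and 7 + o = 4 + (3 + o), so the index is never 2.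
  σ-n n (inj₁ refl) = σ-4+ 1 λ ()
  σ-n n (inj₂ 7≤n) with m≤n⇒∃[o]m+o≡n 7≤n
  ... | o , refl = σ-4+ (3 + o) λ ()
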